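{- Let $$f(x)=\frac{1}{\cos(x)^{s+1}} +\int_{0}^{x}\frac{dy}{\cos(y)^{t+1}},$$ regarded as a formal power series in $x$ whose coefficients are polynomials in the parameters $s,t$. Let $n\ge1$, $\bar n=\lceil n/2\rceil$ and $\underline n=\lfloor n/2\rfloor$. Then, for all $s,t$, $$\ddot H_n(f)= (-1)^{\binom{\bar n}{2}} \Bigl(\prod_{i=0}^{n-1}(2i)!\Bigr) \Bigl(\prod_{l=0}^{\bar n-1}(s+1)_{2l}\Bigr) \Bigl(\prod_{m=0}^{\underline n-1}(t+1)_{2m}\Bigr) \prod_{r=1}^{\bar n}\prod_{c=1}^{\underline n} \frac{(t-s)/2+c-r}{n-r-c+1}.$$
   Context: For a power series $f(x)=\sum_{k\ge0}a_kx^k/k!$, the dilated Hankel determinant is $\ddot H_n(f)=\det(a_{2i+j})_{0\le i,j\le n-1}$. $(\gamma)_m=\gamma(\gamma+1)\cdots(\gamma+m-1)$ is the Pochhammer symbol; empty products equal $1$. -}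

module Defs where

open import Algebra.Bundles using (CommutativeRing; module Semiring)
open import Algebra.Morphism.Structures using (IsRingHomomorphism)
import Algebra.Definitions.RawSemiring as RawSemiringDefinitions
open import Data.Fin.Base using (zero; suc; toℕ)
open import Data.Integer.Base using (+_)
open import Data.Nat.Base as ℕ using (ℕ; zero; suc; _∸_)
open import Data.Nat.Combinatorics using (_C_)
open import Data.Rational.Base using (ℚ; _/_; +-*-rawRing)
open import Data.Vec.Functional using (Vector; removeAt)
open import Level as Level using (_⊔_)

record CommutativeℚAlgebra c ℓ : Set (Level.suc (c ⊔ ℓ)) where
  field
    commutativeRing : CommutativeRing c ℓ

  open CommutativeRing commutativeRing public

  field
    ι                    : ℚ → Carrier
    ι-isRingHomomorphism : IsRingHomomorphism +-*-rawRing rawRing ι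

module Operations {c ℓ} (A : CommutativeℚAlgebra c ℓ) where
  open CommutativeℚAlgebra A hiding (zero)
  open RawSemiringDefinitions (Semiring.rawSemiring semiring) public
    using (_×_; _^_; sum; product)

  nat : ℕ → Carrier
  nat n = n × 1#

  infixl 7 _÷suc_
  -- x ÷suc m  is  x / (m + 1).
  _÷suc_ : Carrier → ℕ → Carrier
  x ÷suc m = x * ι (+ 1 / suc m)

  -- Bounds are exclusive and start from 0:  i = 0, …, n - 1.
  ∑< ∏< : ℕ → (ℕ → Carrier) → Carrier
  ∑< n f = sum {n} (λ i → f (toℕ i))
  ∏< n f = product {n} (λ i → f (toℕ i))

  infixr 8 ∑< ∏<
  syntax ∑< n (λ i → e) = ∑[ i < n ] e
  syntax ∏< n (λ i → e) = ∏[ i < n ] e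

  pochhammer : Carrier → ℕ → Carrier
  pochhammer γ m = ∏[ i < m ] (γ + nat i)

  -- α (α - 1) ⋯ (α - k + 1) / k!
  binomial : Carrier → ℕ → Carrier
  binomial α zero    = 1#
  binomial α (suc k) = binomial α k * (α - nat k) ÷suc k

  -- Laplace expansion along the first row.
  det : ∀ {n} → Vector (Vector Carrier n) n → Carrier
  det {zero}  M = 1#
  det {suc n} M =
    sum (λ j → (- 1#) ^ toℕ j * M zero j * det (λ i → removeAt (M (suc i)) j))

module PowerSeries {c ℓ} (A : CommutativeℚAlgebra c ℓ) where
  open CommutativeℚAlgebra A hiding (zero)
  open Operations A

  -- The sequence a stands for the formal power series  Σ_k a_k x^k / k!.
  -- Hence products are binomial convolutions and integration is a shift.
  Series : Set c
  Series = ℕ → Carrier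

  𝟙 : Series
  𝟙 zero    = 1#
  𝟙 (suc _) = 0#

  infixl 6 _⊕_ _⊖_
  infixl 7 _⊛_
  infixr 8 _⊛^_ _^ˢ_

  _⊕_ _⊖_ _⊛_ : Series → Series → Series
  (a ⊕ b) n = a n + b n
  (a ⊖ b) n = a n - b n
  (a ⊛ b) n = ∑[ k < suc n ] ((n C k) × (a k * b (n ∸ k)))

  _⊛^_ : Series → ℕ → Series
  a ⊛^ zero  = 𝟙
  a ⊛^ suc k = a ⊛ (a ⊛^ k)

  -- Σ_k w_k u^k  for u with zero constant term; then u^k has no terms of
  -- degree below k, so the coefficient of x^n / n! only involves k ≤ n.
  substitute : (ℕ → Carrier) → Series → Series
  substitute w u n = ∑[ k < suc n ] (w k * (u ⊛^ k) n)

  -- The next two are meaningful for g with constant term 1: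
  -- 1 / g = Σ_k (1 - g)^k  and  g^α = Σ_k (α choose k) (g - 1)^k.
  recip : Series → Series
  recip g = substitute (λ _ → 1#) (𝟙 ⊖ g)

  _^ˢ_ : Series → Carrier → Series
  g ^ˢ α = substitute (binomial α) (g ⊖ 𝟙)

  ∫₀ˣ : Series → Series
  ∫₀ˣ a zero    = 0#
  ∫₀ˣ a (suc k) = a k

  cos : Series
  cos zero          = 1#
  cos (suc zero)    = 0#
  cos (suc (suc k)) = - cos k

  dilatedHankel : ℕ → Series → Carrier
  dilatedHankel n a = det {n} (λ i j → a (2 ℕ.* toℕ i ℕ.+ toℕ j))

-- Write sec^γ for the series of 1 / cos(x)^γ. Its recurrence
-- D² sec^γ = γ (γ + 1) sec^(γ+2) - γ² sec^γ does two things. First, splitting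
-- the columns of the dilated Hankel matrix by parity gives the even derivatives
-- of sec^(s+1) and of sec^(t+1), shifted; trading each shift for γ ↦ γ + 2 by
-- triangular column operations leaves the columns
--   e_γ = (D^(2i) sec^γ (0))_i   for  γ = s+1, t+1, s+3, t+3, …
-- and the factors (s+1)_(2l), (t+1)_(2m). Secondly, D^(2i) sec^γ (0) is a
-- polynomial in γ of degree i with leading coefficient (2i-1)!!, so what remains
-- is a Vandermonde determinant in these γ. Differences of two γ of the same
-- parity give factorials, the mixed ones give ±2 ((t-s)/2 + c - r).
module Submission where

open import Algebra.Bundles using (CommutativeMonoid; CommutativeRing)
open import Algebra.Morphism.Structures using (IsRingHomomorphism)
import Algebra.Properties.CommutativeMonoid.Sum as Sum
import Algebra.Properties.CommutativeSemigroup as CommutativeSemigroupProperties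
import Algebra.Properties.Monoid.Mult as Mult
import Algebra.Properties.Semiring.Exp as Exp
import Algebra.Properties.Semiring.Mult as SemiringMult
import Algebra.Properties.Semiring.Sum as SemiringSum
import Algebra.Solver.Ring
open import Algebra.Solver.Ring.AlmostCommutativeRing
  using (_-Raw-AlmostCommutative⟶_; fromCommutativeRing)
open import Data.Fin.Base using (zero; suc; toℕ)
open import Data.Integer.Base as ℤ using (+_; -[1+_])
import Data.Integer.Properties as ℤ
open import Data.Integer.Tactic.RingSolver using (solve-∀)
open import Data.List.Base
  using (List; []; _∷_; [_]; _++_; applyUpTo; length; map; tabulate)
open import Data.List.Membership.Propositional using (_∈_)
open import Data.List.Membership.Propositional.Properties
  using (∈-applyUpTo⁺; ∈-applyUpTo⁻)
open import Data.List.Properties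
  using ( ++-assoc; ++-identityʳ; applyUpTo-∷ʳ; length-applyUpTo; map-++
        ; map-applyUpTo; map-tabulate; map-∘)
open import Data.List.Relation.Unary.Any using (here; there)
open import Data.Maybe.Base as Maybe using (Maybe)
open import Data.Nat.Base as ℕ
  using (ℕ; zero; suc; _∸_; _≤_; _<_; z≤n; s≤s; ⌈_/2⌉; ⌊_/2⌋; _!)
open import Data.Nat.Combinatorics
  using (_C_; k>n⇒nCk≡0; nC1≡n; nCk+nC[k+1]≡[n+1]C[k+1])
import Data.Nat.Properties as ℕ
open import Data.Product.Base using (_,_; ∃-syntax; proj₁; proj₂)
  renaming (_×_ to _&_)
open import Data.Rational.Base as ℚ
  using (ℚ; mkℚ; 0ℚ; 1ℚ; _/_; +-*-rawRing; fromℚᵘ; toℚᵘ)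
import Data.Rational.Properties as ℚ
open import Data.Rational.Unnormalised.Base as ℚᵘ using (mkℚᵘ; *≡*)
import Data.Rational.Unnormalised.Properties as ℚᵘ
open import Data.Sum.Base using (_⊎_; inj₁; inj₂; [_,_]′)
open import Data.Vec.Functional using (Vector; removeAt)
open import Level using (_⊔_)
import Relation.Binary.PropositionalEquality as ≡
open ≡ using (_≡_)
import Relation.Binary.Reasoning.Setoid as ≈-Reasoning
open import Relation.Nullary.Decidable using (dec⇒maybe)

open import Defs

-- An arbitrary commutative ℚ-algebra offers neither analysis nor cancellation, so every step rests
-- on an explicit identity. The power cos^γ is a binomial series in a ring element γ; apart from its
-- constant term, all that is used of it is the differential equation cos (cos^γ)' = γ cos' cos^γ.
-- The exponent law cos sec^(γ+1) = sec^γ then comes from uniqueness: a series with derivative 0 is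
-- constant. Zero divisors rule out root counting for the Vandermonde step; instead polynomials are
-- divided explicitly by x - x₀, which preserves the leading coefficient. The recurrence seems to
-- raise the degree in γ by 2, but its top terms combine into γ² times a difference with step 2,
-- which loses one degree. The constants meet in (2i)! = (2i-1)!! 2^i i!: leading coefficients give
-- (2i-1)!!, the i differences of node i with its predecessors give 2^i, and the same-parity
-- differences give superfactorials of ⌈n/2⌉ and ⌊n/2⌋. Replacing these by the superfactorial of n
-- creates the denominators n - r - c + 1. The sign arises because node 2l has l predecessors with t
-- in place of s.

module RationalSolver {c ℓ} (A : CommutativeℚAlgebra c ℓ) where
  open CommutativeℚAlgebra A hiding (zero)
  open IsRingHomomorphism ι-isRingHomomorphism

  -- Agrees with ι, but sends 0 and 1 to 0# and 1# judgementally, so that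
  -- these constants can be written in the equations to be solved.
  coefficient : ℚ → Carrier
  coefficient (mkℚ (+ 0) 0 _) = 0#
  coefficient (mkℚ (+ 1) 0 _) = 1#
  coefficient q               = ι q

  coefficient≈ι : ∀ q → coefficient q ≈ ι q
  coefficient≈ι (mkℚ (+ 0) 0 _)             = sym 0#-homo
  coefficient≈ι (mkℚ (+ 1) 0 _)             = sym 1#-homo
  coefficient≈ι (mkℚ (+ 0) (suc _) _)       = refl
  coefficient≈ι (mkℚ (+ 1) (suc _) _)       = refl
  coefficient≈ι (mkℚ (+ suc (suc _)) _ _)   = refl
  coefficient≈ι (mkℚ -[1+ _ ] _ _)          = refl

  morphism : +-*-rawRing -Raw-AlmostCommutative⟶ fromCommutativeRing commutativeRing
  morphism = record
    { ⟦_⟧    = coefficient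
    ; +-homo = λ p q → trans (coefficient≈ι _)
        (trans (+-homo p q) (sym (+-cong (coefficient≈ι p) (coefficient≈ι q))))
    ; *-homo = λ p q → trans (coefficient≈ι _)
        (trans (*-homo p q) (sym (*-cong (coefficient≈ι p) (coefficient≈ι q))))
    ; -‿homo = λ p → trans (coefficient≈ι _)
        (trans (-‿homo p) (sym (-‿cong (coefficient≈ι p))))
    ; 0-homo = refl
    ; 1-homo = refl
    }

  coefficient≟ : ∀ p q → Maybe (coefficient p ≈ coefficient q)
  coefficient≟ p q = Maybe.map (λ { ≡.refl → refl }) (dec⇒maybe (p ℚ.≟ q))

  open Algebra.Solver.Ring +-*-rawRing (fromCommutativeRing commutativeRing)
    morphism coefficient≟ public
    using (solve; con; _:=_; _:+_; _:*_; _:-_; :-_)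

-- Finite folds over k < n, for sums and products alike.

module Range {c ℓ} (M : CommutativeMonoid c ℓ) where
  open CommutativeMonoid M
  open Sum M using (sum; ∑-distrib-+)
  open CommutativeSemigroupProperties commutativeSemigroup using (interchange)

  fold : ℕ → (ℕ → Carrier) → Carrier
  fold n f = sum {n} (λ i → f (toℕ i))

  fold-cong-< : ∀ n {f g} → (∀ k → k < n → f k ≈ g k) → fold n f ≈ fold n g
  fold-cong-< zero    f≈g = refl
  fold-cong-< (suc n) f≈g =
    ∙-cong (f≈g 0 (s≤s z≤n)) (fold-cong-< n (λ k k<n → f≈g (suc k) (s≤s k<n)))

  fold-cong : ∀ n {f g} → (∀ k → f k ≈ g k) → fold n f ≈ fold n g
  fold-cong n f≈g = fold-cong-< n (λ k _ → f≈g k)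

  fold-ε : ∀ n → fold n (λ _ → ε) ≈ ε
  fold-ε zero    = refl
  fold-ε (suc n) = trans (identityˡ _) (fold-ε n)

  fold-last : ∀ n f → fold (suc n) f ≈ fold n f ∙ f n
  fold-last zero    f = trans (identityʳ _) (sym (identityˡ _))
  fold-last (suc n) f =
    trans (∙-congˡ (fold-last n (λ k → f (suc k)))) (sym (assoc _ _ _))

  fold-∙ : ∀ n f g → fold n (λ k → f k ∙ g k) ≈ fold n f ∙ fold n g
  fold-∙ n f g = ∑-distrib-+ {n} (λ i → f (toℕ i)) (λ i → g (toℕ i))

  fold-parity : ∀ n f → fold n f ≈
    fold ⌈ n /2⌉ (λ l → f (2 ℕ.* l)) ∙ fold ⌊ n /2⌋ (λ m → f (suc (2 ℕ.* m)))
  fold-parity zero          f = sym (identityˡ _)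
  fold-parity (suc zero)    f = sym (identityʳ _)
  fold-parity (suc (suc n)) f = begin
    f 0 ∙ (f 1 ∙ fold n (λ k → f (suc (suc k))))
      ≈⟨ assoc _ _ _ ⟨
    (f 0 ∙ f 1) ∙ fold n (λ k → f (suc (suc k)))
      ≈⟨ ∙-congˡ (fold-parity n (λ k → f (suc (suc k)))) ⟩
    (f 0 ∙ f 1) ∙ (fold ⌈ n /2⌉ (λ l → f (2 ℕ.+ 2 ℕ.* l)) ∙ fold ⌊ n /2⌋ (λ m → f (3 ℕ.+ 2 ℕ.* m)))
      ≈⟨ interchange _ _ _ _ ⟩
    (f 0 ∙ fold ⌈ n /2⌉ (λ l → f (2 ℕ.+ 2 ℕ.* l))) ∙ (f 1 ∙ fold ⌊ n /2⌋ (λ m → f (3 ℕ.+ 2 ℕ.* m)))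
      ≈⟨ ∙-cong
           (∙-congˡ (fold-cong ⌈ n /2⌉ (λ l → reflexive (≡.cong f (≡.sym (ℕ.*-suc 2 l))))))
           (∙-congˡ (fold-cong ⌊ n /2⌋ (λ m → reflexive (≡.cong (λ k → f (suc k)) (≡.sym (ℕ.*-suc 2 m)))))) ⟩
    (f 0 ∙ fold ⌈ n /2⌉ (λ l → f (2 ℕ.* suc l))) ∙ (f 1 ∙ fold ⌊ n /2⌋ (λ m → f (suc (2 ℕ.* suc m)))) ∎
    where open ≈-Reasoning setoid

-- The commutative ring of exponential power series.

module SeriesRing {c ℓ} (A : CommutativeℚAlgebra c ℓ) where
  open CommutativeℚAlgebra A hiding (zero)
  open Operations A
  open PowerSeries A
  open RationalSolver A
  open Mult +-monoid using (×-congʳ; ×-congˡ; ×-homo-+)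
  open Range +-commutativeMonoid
    renaming ( fold-cong-< to ∑-cong-<; fold-cong to ∑-cong; fold-last to ∑-last
             ; fold-∙ to ∑-+; fold-ε to ∑-0)
  open ≈-Reasoning setoid

  infix 4 _≋_
  _≋_ : Series → Series → Set ℓ
  a ≋ b = ∀ n → a n ≈ b n

  ∂ : Series → Series
  ∂ a n = a (suc n)

  𝟘 : Series
  𝟘 _ = 0#

  ⊝_ : Series → Series
  (⊝ a) n = - a n

  const : Carrier → Series
  const x zero    = x
  const x (suc _) = 0#

  ×-zeroʳ : ∀ n → n × 0# ≈ 0#
  ×-zeroʳ zero    = refl
  ×-zeroʳ (suc n) = trans (+-identityˡ _) (×-zeroʳ n)

  ⊛-zero : ∀ a b → (a ⊛ b) 0 ≈ a 0 * b 0
  ⊛-zero a b = trans (+-identityʳ _) (+-identityʳ _)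

  ⊛-cong-≤ : ∀ n {a a′ b b′} →
    (∀ k → k ≤ n → a k ≈ a′ k) → (∀ k → k ≤ n → b k ≈ b′ k) →
    (a ⊛ b) n ≈ (a′ ⊛ b′) n
  ⊛-cong-≤ n a≈a′ b≈b′ = ∑-cong-< (suc n) λ k k≤n →
    ×-congʳ (n C k) (*-cong (a≈a′ k (ℕ.s≤s⁻¹ k≤n)) (b≈b′ (n ∸ k) (ℕ.m∸n≤m n k)))

  ⊛-cong : ∀ {a a′ b b′} → a ≋ a′ → b ≋ b′ → a ⊛ b ≋ a′ ⊛ b′
  ⊛-cong a≋a′ b≋b′ n = ⊛-cong-≤ n (λ k _ → a≋a′ k) (λ k _ → b≋b′ k)

  -- Pascal's rule splits each binomial coefficient. All ring laws of `⊛` then follow by induction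
  -- on the degree, because differentiation lowers degree n + 1 to n; no double sum has to be
  -- rearranged.
  leibniz : ∀ a b → ∂ (a ⊛ b) ≋ ∂ a ⊛ b ⊕ a ⊛ ∂ b
  leibniz a b n = begin
    first + ∑< (suc n) (λ k → (suc n C suc k) × t k)
      ≈⟨ +-congˡ (∑-cong (suc n) {g = λ k → u k + v k} (λ k → trans
           (×-congˡ {t k} (≡.sym (nCk+nC[k+1]≡[n+1]C[k+1] n k)))
           (×-homo-+ (t k) (n C k) (n C suc k)))) ⟩
    first + ∑< (suc n) (λ k → u k + v k)
      ≈⟨ +-congˡ (∑-+ (suc n) u v) ⟩
    first + ((∂ a ⊛ b) n + ∑< (suc n) v)
      ≈⟨ solve 3 (λ x y z → x :+ (y :+ z) := y :+ (x :+ z)) refl _ _ _ ⟩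
    (∂ a ⊛ b) n + (first + ∑< (suc n) v)
      -- The summand k = n carries C(n, n + 1) = 0. Dropping it leaves k < n, where n ∸ k is a
      -- successor and `∂ b` can be recognised.
      ≈⟨ +-congˡ (+-congˡ (trans (∑-last n v)
           (trans (+-congˡ (×-congˡ {t n} (k>n⇒nCk≡0 (ℕ.n<1+n n)))) (+-identityʳ _)))) ⟩
    (∂ a ⊛ b) n + (first + ∑< n v)
      ≈⟨ +-congˡ (+-congˡ (∑-cong-< n {v} (λ k k<n → ×-congʳ (n C suc k)
           (*-congˡ {a (suc k)} (reflexive (≡.cong b (ℕ.+-∸-assoc 1 k<n))))))) ⟩
    (∂ a ⊛ b) n + (a ⊛ ∂ b) n ∎
    where
    first = (suc n C 0) × (a 0 * b (suc n))
    t : ℕ → Carrier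
    t k = a (suc k) * b (n ∸ k)
    u v : ℕ → Carrier
    u k = (n C k) × t k
    v k = (n C suc k) × t k

  ⊛-distribˡ : ∀ a b c → a ⊛ (b ⊕ c) ≋ a ⊛ b ⊕ a ⊛ c
  ⊛-distribˡ a b c zero = begin
    (a ⊛ (b ⊕ c)) 0             ≈⟨ ⊛-zero a (b ⊕ c) ⟩
    a 0 * (b 0 + c 0)           ≈⟨ distribˡ _ _ _ ⟩
    a 0 * b 0 + a 0 * c 0       ≈⟨ +-cong (⊛-zero a b) (⊛-zero a c) ⟨
    (a ⊛ b) 0 + (a ⊛ c) 0 ∎
  ⊛-distribˡ a b c (suc n) = begin
    (a ⊛ (b ⊕ c)) (suc n)
      ≈⟨ leibniz a (b ⊕ c) n ⟩
    (∂ a ⊛ (b ⊕ c)) n + (a ⊛ (∂ b ⊕ ∂ c)) n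
      ≈⟨ +-cong (⊛-distribˡ (∂ a) b c n) (⊛-distribˡ a (∂ b) (∂ c) n) ⟩
    ((∂ a ⊛ b) n + (∂ a ⊛ c) n) + ((a ⊛ ∂ b) n + (a ⊛ ∂ c) n)
      ≈⟨ solve 4 (λ x y z w → (x :+ y) :+ (z :+ w) := (x :+ z) :+ (y :+ w)) refl _ _ _ _ ⟩
    ((∂ a ⊛ b) n + (a ⊛ ∂ b) n) + ((∂ a ⊛ c) n + (a ⊛ ∂ c) n)
      ≈⟨ +-cong (leibniz a b n) (leibniz a c n) ⟨
    (a ⊛ b) (suc n) + (a ⊛ c) (suc n) ∎

  ⊛-comm : ∀ a b → a ⊛ b ≋ b ⊛ a
  ⊛-comm a b zero = trans (⊛-zero a b) (trans (*-comm _ _) (sym (⊛-zero b a)))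
  ⊛-comm a b (suc n) = begin
    (a ⊛ b) (suc n)             ≈⟨ leibniz a b n ⟩
    (∂ a ⊛ b) n + (a ⊛ ∂ b) n   ≈⟨ +-comm _ _ ⟩
    (a ⊛ ∂ b) n + (∂ a ⊛ b) n   ≈⟨ +-cong (⊛-comm a (∂ b) n) (⊛-comm (∂ a) b n) ⟩
    (∂ b ⊛ a) n + (b ⊛ ∂ a) n   ≈⟨ leibniz b a n ⟨
    (b ⊛ a) (suc n) ∎

  ⊛-distribʳ : ∀ a b c → (b ⊕ c) ⊛ a ≋ b ⊛ a ⊕ c ⊛ a
  ⊛-distribʳ a b c n = begin
    ((b ⊕ c) ⊛ a) n         ≈⟨ ⊛-comm (b ⊕ c) a n ⟩
    (a ⊛ (b ⊕ c)) n         ≈⟨ ⊛-distribˡ a b c n ⟩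
    (a ⊛ b) n + (a ⊛ c) n   ≈⟨ +-cong (⊛-comm a b n) (⊛-comm a c n) ⟩
    (b ⊛ a) n + (c ⊛ a) n   ∎

  ⊛-assoc : ∀ a b c → (a ⊛ b) ⊛ c ≋ a ⊛ (b ⊛ c)
  ⊛-assoc a b c zero = begin
    ((a ⊛ b) ⊛ c) 0     ≈⟨ ⊛-zero (a ⊛ b) c ⟩
    (a ⊛ b) 0 * c 0     ≈⟨ *-congʳ (⊛-zero a b) ⟩
    a 0 * b 0 * c 0     ≈⟨ *-assoc _ _ _ ⟩
    a 0 * (b 0 * c 0)   ≈⟨ *-congˡ (⊛-zero b c) ⟨
    a 0 * (b ⊛ c) 0     ≈⟨ ⊛-zero a (b ⊛ c) ⟨
    (a ⊛ (b ⊛ c)) 0     ∎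
  ⊛-assoc a b c (suc n) = begin
    ((a ⊛ b) ⊛ c) (suc n)
      ≈⟨ leibniz (a ⊛ b) c n ⟩
    (∂ (a ⊛ b) ⊛ c) n + ((a ⊛ b) ⊛ ∂ c) n
      ≈⟨ +-congʳ (trans (⊛-cong {b = c} (leibniz a b) (λ _ → refl) n) (⊛-distribʳ c (∂ a ⊛ b) (a ⊛ ∂ b) n)) ⟩
    (((∂ a ⊛ b) ⊛ c) n + ((a ⊛ ∂ b) ⊛ c) n) + ((a ⊛ b) ⊛ ∂ c) n
      ≈⟨ +-cong (+-cong (⊛-assoc (∂ a) b c n) (⊛-assoc a (∂ b) c n)) (⊛-assoc a b (∂ c) n) ⟩
    ((∂ a ⊛ (b ⊛ c)) n + (a ⊛ (∂ b ⊛ c)) n) + (a ⊛ (b ⊛ ∂ c)) n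
      ≈⟨ +-assoc _ _ _ ⟩
    (∂ a ⊛ (b ⊛ c)) n + ((a ⊛ (∂ b ⊛ c)) n + (a ⊛ (b ⊛ ∂ c)) n)
      ≈⟨ +-congˡ (trans (⊛-cong {a = a} (λ _ → refl) (leibniz b c) n) (⊛-distribˡ a (∂ b ⊛ c) (b ⊛ ∂ c) n)) ⟨
    (∂ a ⊛ (b ⊛ c)) n + (a ⊛ ∂ (b ⊛ c)) n
      ≈⟨ leibniz a (b ⊛ c) n ⟨
    (a ⊛ (b ⊛ c)) (suc n) ∎

  𝟘-⊛ : ∀ a → 𝟘 ⊛ a ≋ 𝟘
  𝟘-⊛ a n = trans
    (∑-cong (suc n) {λ k → (n C k) × (0# * a (n ∸ k))}
      (λ k → trans (×-congʳ (n C k) (zeroˡ _)) (×-zeroʳ (n C k))))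
    (∑-0 (suc n))

  const-⊛ : ∀ x a n → (const x ⊛ a) n ≈ x * a n
  const-⊛ x a zero    = ⊛-zero (const x) a
  const-⊛ x a (suc n) = begin
    (const x ⊛ a) (suc n)              ≈⟨ leibniz (const x) a n ⟩
    (𝟘 ⊛ a) n + (const x ⊛ ∂ a) n      ≈⟨ +-cong (𝟘-⊛ a n) (const-⊛ x (∂ a) n) ⟩
    0# + x * a (suc n)                 ≈⟨ +-identityˡ _ ⟩
    x * a (suc n) ∎

  const-1 : const 1# ≋ 𝟙
  const-1 zero    = refl
  const-1 (suc _) = refl

  ⊛-identityˡ : ∀ a → 𝟙 ⊛ a ≋ a
  ⊛-identityˡ a n = begin
    (𝟙 ⊛ a) n          ≈⟨ ⊛-cong {b = a} const-1 (λ _ → refl) n ⟨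
    (const 1# ⊛ a) n   ≈⟨ const-⊛ 1# a n ⟩
    1# * a n           ≈⟨ *-identityˡ _ ⟩
    a n                ∎

  seriesRing : CommutativeRing c ℓ
  seriesRing = record
    { Carrier = Series ; _≈_ = _≋_ ; _+_ = _⊕_ ; _*_ = _⊛_ ; -_ = ⊝_ ; 0# = 𝟘 ; 1# = 𝟙
    ; isCommutativeRing = record
      { isRing = record
        { +-isAbelianGroup = record
          { isGroup = record
            { isMonoid = record
              { isSemigroup = record
                { isMagma = record
                  { isEquivalence = record
                    { refl  = λ _ → refl
                    ; sym   = λ a≋b n → sym (a≋b n)
                    ; trans = λ a≋b b≋c n → trans (a≋b n) (b≋c n)
                    }
                  ; ∙-cong = λ a≋a′ b≋b′ n → +-cong (a≋a′ n) (b≋b′ n)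
                  }
                ; assoc = λ a b c n → +-assoc (a n) (b n) (c n)
                }
              ; identity = (λ a n → +-identityˡ (a n)) , (λ a n → +-identityʳ (a n))
              }
            ; inverse = (λ a n → -‿inverseˡ (a n)) , (λ a n → -‿inverseʳ (a n))
            ; ⁻¹-cong = λ a≋b n → -‿cong (a≋b n)
            }
          ; comm = λ a b n → +-comm (a n) (b n)
          }
        ; *-cong     = ⊛-cong
        ; *-assoc    = ⊛-assoc
        ; *-identity = ⊛-identityˡ , λ a n → trans (⊛-comm a 𝟙 n) (⊛-identityˡ a n)
        ; distrib    = ⊛-distribˡ , ⊛-distribʳ
        }
      ; *-comm = ⊛-comm
      }
    }

  const-cong : ∀ {x y} → x ≈ y → const x ≋ const y
  const-cong x≈y zero    = x≈y
  const-cong x≈y (suc _) = refl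

  const-+ : ∀ x y → const (x + y) ≋ const x ⊕ const y
  const-+ x y zero    = refl
  const-+ x y (suc n) = sym (+-identityˡ _)

  const-* : ∀ x y → const (x * y) ≋ const x ⊛ const y
  const-* x y zero    = sym (const-⊛ x (const y) 0)
  const-* x y (suc n) = sym (trans (const-⊛ x (const y) (suc n)) (zeroʳ x))

  const-neg : ∀ x → const (- x) ≋ ⊝ const x
  const-neg x zero    = refl
  const-neg x (suc n) = solve 0 (con 0ℚ := :- con 0ℚ) refl

  private module ι = IsRingHomomorphism ι-isRingHomomorphism

  -- With the constants embedded by `const`, the ring solver with rational coefficients becomes
  -- available for identities between whole series.
  seriesAlgebra : CommutativeℚAlgebra c ℓ
  seriesAlgebra = record
    { commutativeRing = seriesRing
    ; ι = λ q → const (ι q)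
    ; ι-isRingHomomorphism = record
      { isSemiringHomomorphism = record
        { isNearSemiringHomomorphism = record
          { +-isMonoidHomomorphism = record
            { isMagmaHomomorphism = record
              { isRelHomomorphism = record { cong = λ p≡q → const-cong (ι.⟦⟧-cong p≡q) }
              ; homo = λ p q n → trans (const-cong (ι.+-homo p q) n) (const-+ _ _ n)
              }
            ; ε-homo = λ { zero → ι.0#-homo ; (suc _) → refl }
            }
          ; *-homo = λ p q n → trans (const-cong (ι.*-homo p q) n) (const-* _ _ n)
          }
        ; 1#-homo = λ n → trans (const-cong ι.1#-homo n) (const-1 n)
        }
      ; -‿homo = λ p n → trans (const-cong (ι.-‿homo p) n) (const-neg _ n)
      }
    }

-- Natural numbers and their reciprocals inside the algebra.

fromℚᵘ-+ : ∀ p q → fromℚᵘ p ℚ.+ fromℚᵘ q ≡ fromℚᵘ (p ℚᵘ.+ q)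
fromℚᵘ-+ p q = ℚ.toℚᵘ-injective (begin
  toℚᵘ (fromℚᵘ p ℚ.+ fromℚᵘ q)          ≈⟨ ℚ.toℚᵘ-homo-+ (fromℚᵘ p) (fromℚᵘ q) ⟩
  toℚᵘ (fromℚᵘ p) ℚᵘ.+ toℚᵘ (fromℚᵘ q)  ≈⟨ ℚᵘ.+-cong (ℚ.toℚᵘ-fromℚᵘ p) (ℚ.toℚᵘ-fromℚᵘ q) ⟩
  p ℚᵘ.+ q                              ≈⟨ ℚ.toℚᵘ-fromℚᵘ (p ℚᵘ.+ q) ⟨
  toℚᵘ (fromℚᵘ (p ℚᵘ.+ q))              ∎)
  where open ≈-Reasoning ℚᵘ.≃-setoid

1/d+m/d≡[1+m]/d : ∀ m k → (+ 1 / suc k) ℚ.+ (+ m / suc k) ≡ + suc m / suc k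
1/d+m/d≡[1+m]/d m k = ≡.trans (fromℚᵘ-+ (mkℚᵘ (+ 1) k) (mkℚᵘ (+ m) k))
  (ℚ.fromℚᵘ-cong {mkℚᵘ (+ 1) k ℚᵘ.+ mkℚᵘ (+ m) k} {mkℚᵘ (+ suc m) k}
    (*≡* (identity (+ m) (+ suc k))))
  where
  identity : ∀ m d → (+ 1 ℤ.* d ℤ.+ m ℤ.* d) ℤ.* d ≡ (+ 1 ℤ.+ m) ℤ.* (d ℤ.* d)
  identity = solve-∀

module Scalars {c ℓ} (A : CommutativeℚAlgebra c ℓ) where
  open CommutativeℚAlgebra A hiding (zero)
  open Operations A
  open IsRingHomomorphism ι-isRingHomomorphism
  open ≈-Reasoning setoid
  open SemiringMult semiring using (×1-homo-*)

  nat-* : ∀ m n → nat (m ℕ.* n) ≈ nat m * nat n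
  nat-* = ×1-homo-*

  -- The numerator is general for the sake of the induction; m = k + 1 gives the inverse law.
  nat-*-ι[1/suc] : ∀ m k → nat m * ι (+ 1 / suc k) ≈ ι (+ m / suc k)
  nat-*-ι[1/suc] zero k = begin
    0# * ι (+ 1 / suc k)  ≈⟨ zeroˡ _ ⟩
    0#                    ≈⟨ 0#-homo ⟨
    ι 0ℚ                  ≈⟨ ⟦⟧-cong (ℚ.fromℚᵘ-cong {mkℚᵘ (+ 0) 0} {mkℚᵘ (+ 0) k} (*≡* ≡.refl)) ⟩
    ι (+ 0 / suc k)       ∎
  nat-*-ι[1/suc] (suc m) k = begin
    (1# + nat m) * ι (+ 1 / suc k)              ≈⟨ distribʳ _ _ _ ⟩
    1# * ι (+ 1 / suc k) + nat m * ι (+ 1 / suc k)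
      ≈⟨ +-cong (*-identityˡ _) (nat-*-ι[1/suc] m k) ⟩
    ι (+ 1 / suc k) + ι (+ m / suc k)           ≈⟨ +-homo _ _ ⟨
    ι ((+ 1 / suc k) ℚ.+ (+ m / suc k))         ≈⟨ ⟦⟧-cong (1/d+m/d≡[1+m]/d m k) ⟩
    ι (+ suc m / suc k)                         ∎

  ÷suc-inverse : ∀ k → nat (suc k) * ι (+ 1 / suc k) ≈ 1#
  ÷suc-inverse k = begin
    nat (suc k) * ι (+ 1 / suc k)  ≈⟨ nat-*-ι[1/suc] (suc k) k ⟩
    ι (+ suc k / suc k)            ≈⟨ ⟦⟧-cong (ℚ.fromℚᵘ-cong {mkℚᵘ (+ suc k) k} {mkℚᵘ (+ 1) 0}
                                        (*≡* (ℤ.*-comm (+ suc k) (+ 1)))) ⟩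
    ι 1ℚ                           ≈⟨ 1#-homo ⟩
    1#                             ∎

-- Composition of series, reciprocals, and powers with exponent in the ring.

module Substitution {c ℓ} (A : CommutativeℚAlgebra c ℓ) where
  open CommutativeℚAlgebra A hiding (zero)
  open Operations A
  open PowerSeries A
  open RationalSolver A
  open Scalars A
  open SeriesRing A
  open Range +-commutativeMonoid
    renaming ( fold-cong-< to ∑-cong-<; fold-cong to ∑-cong; fold-last to ∑-last
             ; fold-∙ to ∑-+; fold-ε to ∑-0)
  open SemiringSum semiring using (*-distribˡ-sum)
  open Mult +-monoid using (×-congʳ)
  module S where
    open CommutativeRing seriesRing public
    open RationalSolver seriesAlgebra public
  open ≈-Reasoning setoid

  ⊛-≈0 : ∀ a b n → (∀ k → k ≤ n → a k * b (n ∸ k) ≈ 0#) → (a ⊛ b) n ≈ 0#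
  ⊛-≈0 a b n h = trans
    (∑-cong-< (suc n) {λ k → (n C k) × (a k * b (n ∸ k))}
      (λ k k≤n → trans (×-congʳ (n C k) (h k (ℕ.s≤s⁻¹ k≤n))) (×-zeroʳ (n C k))))
    (∑-0 (suc n))

  ⊛^-vanishes : ∀ u → u 0 ≈ 0# → ∀ k n → n < k → (u ⊛^ k) n ≈ 0#
  ⊛^-vanishes u u₀≈0 (suc k) n (s≤s n≤k) = ⊛-≈0 u (u ⊛^ k) n λ where
    zero    _         → trans (*-congʳ u₀≈0) (zeroˡ _)
    (suc j) 1+j≤n → trans (*-congˡ (⊛^-vanishes u u₀≈0 k (n ∸ suc j)
      (ℕ.<-≤-trans (ℕ.∸-monoʳ-< (s≤s z≤n) 1+j≤n) n≤k))) (zeroʳ _)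

  -- `substitute` cuts its sum at a place that depends on the degree. With a cutoff N common to all
  -- degrees the sum is a genuine linear combination of series, to which ring laws apply.
  ∑ˢ : ℕ → (ℕ → Carrier) → (ℕ → Series) → Series
  ∑ˢ N w v n = ∑< N (λ k → w k * v k n)

  ⊛-∑ˢ : ∀ N a w v → a ⊛ ∑ˢ N w v ≋ ∑ˢ N w (λ k → a ⊛ v k)
  ⊛-∑ˢ zero    a w v = S.zeroʳ a
  ⊛-∑ˢ (suc N) a w v n = begin
    (a ⊛ ∑ˢ (suc N) w v) n
      ≈⟨ ⊛-cong {a} {b = ∑ˢ (suc N) w v} (λ _ → refl)
           (λ m → +-congʳ {∑ˢ N w′ v′ m} (sym (const-⊛ (w 0) (v 0) m))) n ⟩
    (a ⊛ (const (w 0) ⊛ v 0 ⊕ ∑ˢ N w′ v′)) n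
      ≈⟨ S.solve 4 (λ x y z t → x S.:* (y S.:* z S.:+ t) S.:= y S.:* (x S.:* z) S.:+ x S.:* t)
           S.refl a (const (w 0)) (v 0) (∑ˢ N w′ v′) n ⟩
    (const (w 0) ⊛ (a ⊛ v 0)) n + (a ⊛ ∑ˢ N w′ v′) n
      ≈⟨ +-cong (const-⊛ (w 0) (a ⊛ v 0) n) (⊛-∑ˢ N a w′ v′ n) ⟩
    ∑ˢ (suc N) w (λ k → a ⊛ v k) n ∎
    where
    w′ : ℕ → Carrier
    w′ k = w (suc k)
    v′ : ℕ → Series
    v′ k = v (suc k)

  module _ (u : Series) (u₀≈0 : u 0 ≈ 0#) where

    -- The additional terms involve u^k with k > n, which have no coefficient in degree n.
    substitute-∑ˢ : ∀ w n m → ∑ˢ (m ℕ.+ suc n) w (u ⊛^_) n ≈ substitute w u n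
    substitute-∑ˢ w n zero    = refl
    substitute-∑ˢ w n (suc m) = begin
      ∑ˢ (suc N) w (u ⊛^_) n          ≈⟨ ∑-last N (λ k → w k * (u ⊛^ k) n) ⟩
      ∑ˢ N w (u ⊛^_) n + w N * (u ⊛^ N) n
        ≈⟨ +-cong (substitute-∑ˢ w n m)
             (*-congˡ (⊛^-vanishes u u₀≈0 N n (ℕ.m≤n+m (suc n) m))) ⟩
      substitute w u n + w N * 0#     ≈⟨ +-congˡ (zeroʳ _) ⟩
      substitute w u n + 0#           ≈⟨ +-identityʳ _ ⟩
      substitute w u n                ∎
      where N = m ℕ.+ suc n

    ⊛-substitute : ∀ a w n → (a ⊛ substitute w u) n ≈ ∑ˢ (suc n) w (λ k → a ⊛ (u ⊛^ k)) n
    ⊛-substitute a w n = begin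
      (a ⊛ substitute w u) n
        ≈⟨ ⊛-cong-≤ n {a} (λ _ _ → refl) (λ k k≤n → trans
             (sym (substitute-∑ˢ w k (n ∸ k)))
             (reflexive (≡.cong (λ N → ∑ˢ N w (u ⊛^_) k)
               (≡.trans (ℕ.+-suc (n ∸ k) k) (≡.cong suc (ℕ.m∸n+n≡m k≤n)))))) ⟩
      (a ⊛ ∑ˢ (suc n) w (u ⊛^_)) n
        ≈⟨ ⊛-∑ˢ (suc n) a w (u ⊛^_) n ⟩
      ∑ˢ (suc n) w (λ k → a ⊛ (u ⊛^ k)) n ∎

    -- Coefficients of z W(z), where W(z) = Σ w_k z^k is the outer series. It is an ordinary series,
    -- not an exponential one.
    shift : (ℕ → Carrier) → ℕ → Carrier
    shift w zero    = 0#
    shift w (suc k) = w k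

    ⊛-shift : ∀ w → u ⊛ substitute w u ≋ substitute (shift w) u
    ⊛-shift w n = begin
      (u ⊛ substitute w u) n                     ≈⟨ ⊛-substitute u w n ⟩
      ∑ˢ (suc n) w (λ k → u ⊛^ suc k) n          ≈⟨ trans (+-congʳ (zeroˡ _)) (+-identityˡ _) ⟨
      ∑ˢ (1 ℕ.+ suc n) (shift w) (u ⊛^_) n       ≈⟨ substitute-∑ˢ (shift w) n 1 ⟩
      substitute (shift w) u n                   ∎

    ∂-⊛^ : ∀ k → ∂ (u ⊛^ suc k) ≋ const (nat (suc k)) ⊛ (∂ u ⊛ (u ⊛^ k))
    ∂-⊛^ zero n = begin
      ∂ (u ⊛ 𝟙) n                          ≈⟨ leibniz u 𝟙 n ⟩
      (∂ u ⊛ 𝟙 ⊕ u ⊛ 𝟘) n                  ≈⟨ S.solve 2 (λ x y →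
                                                x S.:* S.con 1ℚ S.:+ y S.:* S.con 0ℚ
                                                S.:= S.con 1ℚ S.:* (x S.:* S.con 1ℚ))
                                              S.refl (∂ u) u n ⟩
      (𝟙 ⊛ (∂ u ⊛ 𝟙)) n                    ≈⟨ ⊛-cong {b = ∂ u ⊛ 𝟙} (λ m → trans (sym (const-1 m))
                                                (const-cong (sym (+-identityʳ 1#)) m))
                                              (λ _ → refl) n ⟩
      (const (nat 1) ⊛ (∂ u ⊛ 𝟙)) n        ∎
    ∂-⊛^ (suc k) n = begin
      ∂ (u ⊛ (u ⊛^ suc k)) n
        ≈⟨ leibniz u (u ⊛^ suc k) n ⟩
      (∂ u ⊛ (u ⊛^ suc k) ⊕ u ⊛ ∂ (u ⊛^ suc k)) n
        ≈⟨ +-congˡ (⊛-cong {u} (λ _ → refl) (∂-⊛^ k) n) ⟩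
      (∂ u ⊛ (u ⊛ (u ⊛^ k)) ⊕ u ⊛ (const (nat (suc k)) ⊛ (∂ u ⊛ (u ⊛^ k)))) n
        ≈⟨ S.solve 4 (λ d x y c →
               d S.:* (x S.:* y) S.:+ x S.:* (c S.:* (d S.:* y))
               S.:= (S.con 1ℚ S.:+ c) S.:* (d S.:* (x S.:* y)))
             S.refl (∂ u) u (u ⊛^ k) (const (nat (suc k))) n ⟩
      ((𝟙 ⊕ const (nat (suc k))) ⊛ (∂ u ⊛ (u ⊛^ suc k))) n
        ≈⟨ ⊛-cong {b = ∂ u ⊛ (u ⊛^ suc k)} (λ m → trans
             (const-+ 1# (nat (suc k)) m) (+-congʳ (const-1 m))) (λ _ → refl) n ⟨
      (const (nat (suc (suc k))) ⊛ (∂ u ⊛ (u ⊛^ suc k))) n ∎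

    derivative : (ℕ → Carrier) → ℕ → Carrier
    derivative w k = nat (suc k) * w (suc k)

    -- The chain rule: the power rule `∂-⊛^` applied term by term.
    ∂-substitute : ∀ w → ∂ (substitute w u) ≋ ∂ u ⊛ substitute (derivative w) u
    ∂-substitute w n = begin
      w 0 * 0# + ∑< (suc n) (λ k → w (suc k) * ∂ (u ⊛^ suc k) n)
        ≈⟨ trans (+-congʳ (zeroʳ _)) (+-identityˡ _) ⟩
      ∑< (suc n) (λ k → w (suc k) * ∂ (u ⊛^ suc k) n)
        ≈⟨ ∑-cong (suc n) {g = λ k → derivative w k * (∂ u ⊛ (u ⊛^ k)) n} (λ k → trans
             (*-congˡ (trans (∂-⊛^ k n) (const-⊛ (nat (suc k)) (∂ u ⊛ (u ⊛^ k)) n)))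
             (solve 3 (λ x y z → x :* (y :* z) := y :* x :* z) refl _ _ _)) ⟩
      ∑ˢ (suc n) (derivative w) (λ k → ∂ u ⊛ (u ⊛^ k)) n
        ≈⟨ ⊛-substitute (∂ u) (derivative w) n ⟨
      (∂ u ⊛ substitute (derivative w) u) n ∎

    substitute-+ : ∀ w w′ → substitute (λ k → w k + w′ k) u ≋ substitute w u ⊕ substitute w′ u
    substitute-+ w w′ n = trans
      (∑-cong (suc n) {g = λ k → w k * (u ⊛^ k) n + w′ k * (u ⊛^ k) n} (λ k → distribʳ _ _ _))
      (∑-+ (suc n) (λ k → w k * (u ⊛^ k) n) (λ k → w′ k * (u ⊛^ k) n))

    substitute-* : ∀ x w → substitute (λ k → x * w k) u ≋ const x ⊛ substitute w u
    substitute-* x w n = begin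
      ∑< (suc n) (λ k → x * w k * (u ⊛^ k) n)
        ≈⟨ ∑-cong (suc n) {λ k → x * w k * (u ⊛^ k) n} (λ k → *-assoc _ _ _) ⟩
      ∑< (suc n) (λ k → x * (w k * (u ⊛^ k) n))
        ≈⟨ *-distribˡ-sum {suc n} x (λ i → w (toℕ i) * (u ⊛^ toℕ i) n) ⟨
      x * substitute w u n
        ≈⟨ const-⊛ x (substitute w u) n ⟨
      (const x ⊛ substitute w u) n ∎

    substitute-cong : ∀ {w w′} → (∀ k → w k ≈ w′ k) → substitute w u ≋ substitute w′ u
    substitute-cong {w} w≈w′ n =
      ∑-cong (suc n) {λ k → w k * (u ⊛^ k) n} (λ k → *-congʳ (w≈w′ k))

    substitute-𝟙 : substitute 𝟙 u ≋ 𝟙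
    substitute-𝟙 n = begin
      1# * 𝟙 n + ∑< n (λ k → 0# * (u ⊛^ suc k) n)
        ≈⟨ +-cong (*-identityˡ _) (trans (∑-cong n {λ k → 0# * (u ⊛^ suc k) n} (λ k → zeroˡ _)) (∑-0 n)) ⟩
      𝟙 n + 0#  ≈⟨ +-identityʳ _ ⟩
      𝟙 n       ∎

  -- With u = 1 - g, the geometric series R satisfies R = 1 + u R, that is, g R = 1.
  ⊛-recip : ∀ g → g 0 ≈ 1# → g ⊛ recip g ≋ 𝟙
  ⊛-recip g g₀≈1 n = begin
    (g ⊛ recip g) n
      ≈⟨ S.solve 2 (λ g r → g S.:* r S.:= r S.:- (S.con 1ℚ S.:- g) S.:* r) S.refl g (recip g) n ⟩
    (recip g ⊖ (𝟙 ⊖ g) ⊛ recip g) n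
      ≈⟨ +-congʳ (unfold n) ⟩
    (𝟙 ⊕ (𝟙 ⊖ g) ⊛ recip g ⊖ (𝟙 ⊖ g) ⊛ recip g) n
      ≈⟨ solve 2 (λ x y → x :+ y :- y := x) refl _ _ ⟩
    𝟙 n ∎
    where
    u₀≈0 : (𝟙 ⊖ g) 0 ≈ 0#
    u₀≈0 = trans (+-congˡ (-‿cong g₀≈1)) (-‿inverseʳ 1#)
    w = shift (𝟙 ⊖ g) u₀≈0 (λ _ → 1#)
    unfold : recip g ≋ 𝟙 ⊕ (𝟙 ⊖ g) ⊛ recip g
    unfold m = begin
      recip g m
        ≈⟨ substitute-cong (𝟙 ⊖ g) u₀≈0 {λ _ → 1#} {λ k → 𝟙 k + w k}
             (λ { zero → sym (+-identityʳ 1#) ; (suc k) → sym (+-identityˡ 1#) }) m ⟩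
      substitute (λ k → 𝟙 k + w k) (𝟙 ⊖ g) m
        ≈⟨ substitute-+ (𝟙 ⊖ g) u₀≈0 𝟙 w m ⟩
      substitute 𝟙 (𝟙 ⊖ g) m + substitute w (𝟙 ⊖ g) m
        ≈⟨ +-cong (substitute-𝟙 (𝟙 ⊖ g) u₀≈0 m) (sym (⊛-shift (𝟙 ⊖ g) u₀≈0 (λ _ → 1#) m)) ⟩
      (𝟙 ⊕ (𝟙 ⊖ g) ⊛ recip g) m ∎

  ^ˢ-zero : ∀ g α → (g ^ˢ α) 0 ≈ 1#
  ^ˢ-zero g α = trans (+-identityʳ _) (*-identityˡ _)

  binomial-suc : ∀ α k → nat (suc k) * binomial α (suc k) ≈ binomial α k * (α - nat k)
  binomial-suc α k = begin
    nat (suc k) * (b * ι (+ 1 / suc k))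
      ≈⟨ solve 3 (λ x y z → x :* (y :* z) := y :* (x :* z)) refl _ _ _ ⟩
    b * (nat (suc k) * ι (+ 1 / suc k))
      ≈⟨ *-congˡ (÷suc-inverse k) ⟩
    b * 1#
      ≈⟨ *-identityʳ _ ⟩
    b ∎
    where b = binomial α k * (α - nat k)

  -- By the chain rule with u = g - 1 it is enough that W = Σ (α choose k) z^k satisfies (1 + z) W'
  -- = α W. On coefficients this reads (k+1) (α choose k+1) + k (α choose k) = α (α choose k).
  ⊛-∂-^ˢ : ∀ g α → g 0 ≈ 1# → g ⊛ ∂ (g ^ˢ α) ≋ const α ⊛ (∂ g ⊛ (g ^ˢ α))
  ⊛-∂-^ˢ g α g₀≈1 n = begin
    (g ⊛ ∂ (g ^ˢ α)) n
      ≈⟨ ⊛-cong {g} (λ _ → refl) (∂-substitute u u₀≈0 (binomial α)) n ⟩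
    (g ⊛ (∂ u ⊛ Q)) n
      ≈⟨ S.solve 3 (λ g d q →
             g S.:* (d S.:* q) S.:= d S.:* (q S.:+ (g S.:- S.con 1ℚ) S.:* q))
           S.refl g (∂ u) Q n ⟩
    (∂ u ⊛ (Q ⊕ u ⊛ Q)) n
      ≈⟨ ⊛-cong {∂ u} {∂ g} {Q ⊕ u ⊛ Q} (λ m → trans
           (+-congˡ (solve 0 (:- con 0ℚ := con 0ℚ) refl)) (+-identityʳ _)) equation n ⟩
    (∂ g ⊛ (const α ⊛ (g ^ˢ α))) n
      ≈⟨ S.solve 3 (λ d a p → d S.:* (a S.:* p) S.:= a S.:* (d S.:* p)) S.refl (∂ g) (const α) (g ^ˢ α) n ⟩
    (const α ⊛ (∂ g ⊛ (g ^ˢ α))) n ∎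
    where
    u = g ⊖ 𝟙
    u₀≈0 : u 0 ≈ 0#
    u₀≈0 = trans (+-congʳ g₀≈1) (-‿inverseʳ 1#)
    w′ = derivative u u₀≈0 (binomial α)
    Q = substitute w′ u
    coefficients : ∀ k → w′ k + shift u u₀≈0 w′ k ≈ α * binomial α k
    coefficients zero = begin
      w′ 0 + 0#              ≈⟨ +-congʳ (binomial-suc α 0) ⟩
      1# * (α - 0#) + 0#     ≈⟨ solve 1 (λ a → con 1ℚ :* (a :- con 0ℚ) :+ con 0ℚ := a :* con 1ℚ) refl α ⟩
      α * 1#                 ∎
    coefficients (suc k) = begin
      w′ (suc k) + nat (suc k) * b
        ≈⟨ +-congʳ (binomial-suc α (suc k)) ⟩
      b * (α - nat (suc k)) + nat (suc k) * b
        ≈⟨ solve 3 (λ b a n → b :* (a :- n) :+ n :* b := a :* b) refl b α (nat (suc k)) ⟩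
      α * b ∎
      where b = binomial α (suc k)
    equation : Q ⊕ u ⊛ Q ≋ const α ⊛ (g ^ˢ α)
    equation m = begin
      Q m + (u ⊛ Q) m
        ≈⟨ +-congˡ (⊛-shift u u₀≈0 w′ m) ⟩
      Q m + substitute (shift u u₀≈0 w′) u m
        ≈⟨ substitute-+ u u₀≈0 w′ (shift u u₀≈0 w′) m ⟨
      substitute (λ k → w′ k + shift u u₀≈0 w′ k) u m
        ≈⟨ substitute-cong u u₀≈0 coefficients m ⟩
      substitute (λ k → α * binomial α k) u m
        ≈⟨ substitute-* u u₀≈0 α (binomial α) m ⟩
      (const α ⊛ (g ^ˢ α)) m ∎

-- To derive a ≈ b from equations lᵢ ≈ rᵢ it suffices to exhibit a - b as a
-- linear combination of the lᵢ - rᵢ, which is a plain ring identity.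
module LinearCombination {c ℓ} (R : CommutativeRing c ℓ) where
  open CommutativeRing R
  open ≈-Reasoning setoid

  x*[l-r]≈0 : ∀ x {l r} → l ≈ r → x * (l - r) ≈ 0#
  x*[l-r]≈0 x {l} {r} l≈r = begin
    x * (l - r)  ≈⟨ *-congˡ (+-congʳ l≈r) ⟩
    x * (r - r)  ≈⟨ *-congˡ (-‿inverseʳ r) ⟩
    x * 0#       ≈⟨ zeroʳ x ⟩
    0#           ∎

  combine₁ : ∀ {a b l r} x → l ≈ r → a ≈ b + x * (l - r) → a ≈ b
  combine₁ x l≈r a≈ = trans a≈ (trans (+-congˡ (x*[l-r]≈0 x l≈r)) (+-identityʳ _))

  combine₂ : ∀ {a b l r l′ r′} x y → l ≈ r → l′ ≈ r′ →
    a ≈ b + x * (l - r) + y * (l′ - r′) → a ≈ b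
  combine₂ x y l≈r l′≈r′ a≈ = combine₁ x l≈r (combine₁ y l′≈r′ a≈)

  combine₃ : ∀ {a b l r l′ r′ l″ r″} x y z → l ≈ r → l′ ≈ r′ → l″ ≈ r″ →
    a ≈ b + x * (l - r) + y * (l′ - r′) + z * (l″ - r″) → a ≈ b
  combine₃ x y z l≈r l′≈r′ l″≈r″ a≈ = combine₂ x y l≈r l′≈r′ (combine₁ z l″≈r″ a≈)

-- Formal powers of the secant and their second-order recurrence.

module SecantPowers {c ℓ} (A : CommutativeℚAlgebra c ℓ) where
  open CommutativeℚAlgebra A hiding (zero)
  open Operations A
  open PowerSeries A
  open SeriesRing A
  open RationalSolver seriesAlgebra
  private module ℛ = RationalSolver A
  open Substitution A using (⊛-recip; ^ˢ-zero; ⊛-∂-^ˢ)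
  open LinearCombination seriesRing
  private module S = CommutativeRing seriesRing

  cos^ sec^ : Carrier → Series
  cos^ γ = cos ^ˢ γ
  sec^ γ = recip (cos^ γ)

  ∂cos : Series
  ∂cos = ∂ cos

  ∂≋𝟘⇒const : ∀ a → ∂ a ≋ 𝟘 → a ≋ const (a 0)
  ∂≋𝟘⇒const a ∂a≋𝟘 zero    = refl
  ∂≋𝟘⇒const a ∂a≋𝟘 (suc n) = ∂a≋𝟘 n

  cos-cancelˡ : ∀ a b → cos ⊛ a ≋ cos ⊛ b → a ≋ b
  cos-cancelˡ a b eq = combine₃ {a} {b} (recip cos) (⊝ a) b eq cos⊛sec≋𝟙 cos⊛sec≋𝟙
    (solve 4 (λ k r a b → a := b :+ r :* (k :* a :- k :* b)
        :+ (:- a) :* (k :* r :- con 1ℚ) :+ b :* (k :* r :- con 1ℚ))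
      S.refl cos (recip cos) a b)
    where cos⊛sec≋𝟙 = ⊛-recip cos refl

  -- The derivative cancels termwise because cos'' = - cos holds by definition, so only the constant
  -- term has to be computed.
  ∂cos²+cos²≋𝟙 : ∂cos ⊛ ∂cos ⊕ cos ⊛ cos ≋ 𝟙
  ∂cos²+cos²≋𝟙 n = begin
    y n              ≈⟨ ∂≋𝟘⇒const y ∂y≋𝟘 n ⟩
    const (y 0) n    ≈⟨ const-cong y₀≈1 n ⟩
    const 1# n       ≈⟨ const-1 n ⟩
    𝟙 n              ∎
    where
    open ≈-Reasoning setoid
    y = ∂cos ⊛ ∂cos ⊕ cos ⊛ cos
    y₀≈1 : y 0 ≈ 1#
    y₀≈1 = trans (+-cong (⊛-zero ∂cos ∂cos) (⊛-zero cos cos))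
      (ℛ.solve 0 (ℛ.con 0ℚ ℛ.:* ℛ.con 0ℚ ℛ.:+ ℛ.con 1ℚ ℛ.:* ℛ.con 1ℚ ℛ.:= ℛ.con 1ℚ) refl)
    ∂y≋𝟘 : ∂ y ≋ 𝟘
    ∂y≋𝟘 m = trans (+-cong (leibniz ∂cos ∂cos m) (leibniz cos cos m))
      (solve 2 (λ k d → ((:- k) :* d :+ d :* (:- k)) :+ (d :* k :+ k :* d) := con 0ℚ)
        S.refl cos ∂cos m)

  module _ (γ : Carrier) where

    cos^⊛sec^ : cos^ γ ⊛ sec^ γ ≋ 𝟙
    cos^⊛sec^ = ⊛-recip (cos^ γ) (^ˢ-zero cos γ)

    sec^-zero : sec^ γ 0 ≈ 1#
    sec^-zero = trans (+-identityʳ _) (*-identityˡ _)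

    cos⊛∂cos^ : cos ⊛ ∂ (cos^ γ) ≋ const γ ⊛ (∂cos ⊛ cos^ γ)
    cos⊛∂cos^ = ⊛-∂-^ˢ cos γ refl

    ∂[cos^⊛sec^] : ∂ (cos^ γ) ⊛ sec^ γ ⊕ cos^ γ ⊛ ∂ (sec^ γ) ≋ 𝟘
    ∂[cos^⊛sec^] n = trans (sym (leibniz (cos^ γ) (sec^ γ) n)) (cos^⊛sec^ (suc n))

    -- Differentiate cos^γ sec^γ = 1, multiply by cos sec^γ, and insert `cos⊛∂cos^` and cos^γ sec^γ
    -- = 1; the weights record these multiplications.
    cos⊛∂sec^ : cos ⊛ ∂ (sec^ γ) ≋ ⊝ (const γ ⊛ (∂cos ⊛ sec^ γ))
    cos⊛∂sec^ = combine₃ {cos ⊛ ∂ G} {⊝ (const γ ⊛ (∂cos ⊛ G))}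
        (⊝ (cos ⊛ ∂ G) ⊖ const γ ⊛ (∂cos ⊛ G)) (cos ⊛ G) (⊝ (G ⊛ G))
        cos^⊛sec^ ∂[cos^⊛sec^] cos⊛∂cos^
        (solve 7 (λ c k d p p′ g g′ →
            k :* g′ :=
            (:- (c :* (d :* g)))
            :+ (:- (k :* g′) :- c :* (d :* g)) :* (p :* g :- con 1ℚ)
            :+ (k :* g) :* ((p′ :* g :+ p :* g′) :- con 0ℚ)
            :+ (:- (g :* g)) :* (k :* p′ :- c :* (d :* p)))
          S.refl (const γ) cos ∂cos (cos^ γ) (∂ (cos^ γ)) G (∂ G))
      where G = sec^ γ

  const-suc : ∀ γ → const (γ + 1#) ≋ const γ ⊕ 𝟙
  const-suc γ n = trans (const-+ γ 1# n) (+-congˡ (const-1 n))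

  -- For y = cos sec^(γ+1), the product y cos^γ has derivative 0 and constant term 1, hence equals
  -- 1. Both y and sec^γ are then inverse to cos^γ. This avoids convolving binomial coefficients.
  cos⊛sec^-suc : ∀ γ → cos ⊛ sec^ (γ + 1#) ≋ sec^ γ
  cos⊛sec^-suc γ = combine₂ {y} {sec^ γ} (sec^ γ) (⊝ y) y⊛cos^≋𝟙 (cos^⊛sec^ γ)
    (solve 3 (λ y p g → y := g :+ g :* (y :* p :- con 1ℚ) :+ (:- y) :* (p :* g :- con 1ℚ))
      S.refl y (cos^ γ) (sec^ γ))
    where
    open ≈-Reasoning setoid
    y P H : Series
    y = cos ⊛ sec^ (γ + 1#)
    P = cos^ γ
    H = sec^ (γ + 1#)
    ∂[y⊛cos^]≋𝟘 : ∂ (y ⊛ P) ≋ 𝟘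
    -- The derivative is computed after multiplication by cos, since cos (cos^γ)' and cos
    -- (sec^(γ+1))' are the known quantities.
    ∂[y⊛cos^]≋𝟘 = cos-cancelˡ (∂ (y ⊛ P)) 𝟘 (combine₁ {cos ⊛ ∂ (y ⊛ P)} {cos ⊛ 𝟘} cos
      (λ n → trans (leibniz y P n) (+-congʳ (⊛-cong {b = P} (leibniz cos H) (λ _ → refl) n)))
      (combine₃ (cos ⊛ H) (cos ⊛ P) (⊝ (cos ⊛ ∂cos ⊛ H ⊛ P))
        (cos⊛∂cos^ γ) (cos⊛∂sec^ (γ + 1#)) (const-suc γ)
        (solve 9 (λ c c′ k d p p′ h h′ z →
            k :* z :=
            k :* con 0ℚ
            :+ k :* (z :- ((d :* h :+ k :* h′) :* p :+ k :* h :* p′))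
            :+ (k :* h) :* (k :* p′ :- c :* (d :* p))
            :+ (k :* p) :* (k :* h′ :- (:- (c′ :* (d :* h))))
            :+ (:- (k :* d :* h :* p)) :* (c′ :- (c :+ con 1ℚ)))
          S.refl (const γ) (const (γ + 1#)) cos ∂cos P (∂ P) H (∂ H) (∂ (y ⊛ P)))))
    y₀≈1 : (y ⊛ P) 0 ≈ 1#
    y₀≈1 = trans (⊛-zero y P) (trans
      (*-cong (trans (⊛-zero cos H) (*-congˡ (sec^-zero (γ + 1#)))) (^ˢ-zero cos γ))
      (ℛ.solve 0 (ℛ.con 1ℚ ℛ.:* ℛ.con 1ℚ ℛ.:* ℛ.con 1ℚ ℛ.:= ℛ.con 1ℚ) refl))
    y⊛cos^≋𝟙 : y ⊛ P ≋ 𝟙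
    y⊛cos^≋𝟙 n = begin
      (y ⊛ P) n              ≈⟨ ∂≋𝟘⇒const (y ⊛ P) ∂[y⊛cos^]≋𝟘 n ⟩
      const ((y ⊛ P) 0) n    ≈⟨ const-cong y₀≈1 n ⟩
      const 1# n             ≈⟨ const-1 n ⟩
      𝟙 n                    ∎

  ∂sec^ : ∀ γ → ∂ (sec^ γ) ≋ ⊝ (const γ ⊛ (∂cos ⊛ sec^ (γ + 1#)))
  ∂sec^ γ = cos-cancelˡ (∂ (sec^ γ)) (⊝ (const γ ⊛ (∂cos ⊛ H)))
    (combine₂ {cos ⊛ ∂ (sec^ γ)} {cos ⊛ (⊝ (const γ ⊛ (∂cos ⊛ H)))} 𝟙 (const γ ⊛ ∂cos)
      (cos⊛∂sec^ γ) (cos⊛sec^-suc γ)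
      (solve 6 (λ c k d g g′ h →
          k :* g′ := k :* (:- (c :* (d :* h)))
          :+ con 1ℚ :* (k :* g′ :- :- (c :* (d :* g)))
          :+ (c :* d) :* (k :* h :- g))
        S.refl (const γ) cos ∂cos (sec^ γ) (∂ (sec^ γ)) H))
    where H = sec^ (γ + 1#)

  sec^-one : ∀ γ → sec^ γ 1 ≈ 0#
  sec^-one γ = begin
    sec^ γ 1                      ≈⟨ ∂sec^ γ 0 ⟩
    - (const γ ⊛ (∂cos ⊛ H)) 0    ≈⟨ -‿cong (⊛-zero (const γ) (∂cos ⊛ H)) ⟩
    - (γ * (∂cos ⊛ H) 0)          ≈⟨ -‿cong (*-congˡ (⊛-zero ∂cos H)) ⟩
    - (γ * (0# * H 0))            ≈⟨ ℛ.solve 2 (λ x h →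
                                       ℛ.:- (x ℛ.:* (ℛ.con 0ℚ ℛ.:* h)) ℛ.:= ℛ.con 0ℚ) refl γ (H 0) ⟩
    0#                            ∎
    where
    open ≈-Reasoning setoid
    H = sec^ (γ + 1#)

  -- Differentiating - γ cos' sec^(γ+1) gives γ cos sec^(γ+1) + γ (γ+1) cos'^2 sec^(γ+2). Now cos'^2
  -- = 1 - cos^2, and cos sec^(δ+1) = sec^δ for δ = γ and δ = γ + 1 absorbs every remaining cos.
  ∂∂sec^ : ∀ γ → ∂ (∂ (sec^ γ)) ≋
    const γ ⊛ (const γ ⊕ 𝟙) ⊛ sec^ (γ + 1# + 1#) ⊖ const γ ⊛ const γ ⊛ sec^ γ
  ∂∂sec^ γ = combine₃ {∂ (∂ (sec^ γ))} {const γ ⊛ (const γ ⊕ 𝟙) ⊛ G₂ ⊖ const γ ⊛ const γ ⊛ sec^ γ}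
      𝟙 (⊝ (const γ ⊛ ∂cos)) (const γ ⊛ ∂cos ⊛ ∂cos ⊛ G₂)
      unfold (∂sec^ (γ + 1#)) (const-suc γ)
    (combine₃ (const γ ⊛ (const γ ⊕ 𝟙) ⊛ G₂) (⊝ (const γ ⊛ (const γ ⊕ 𝟙) ⊛ cos)) (⊝ (const γ ⊛ const γ))
      ∂cos²+cos²≋𝟙 (cos⊛sec^-suc (γ + 1#)) (cos⊛sec^-suc γ)
      (solve 9 (λ c c′ k d g g₁ g₁′ g₂ z →
          z := (c :* (c :+ con 1ℚ) :* g₂ :- c :* c :* g)
          :+ con 1ℚ :* (z :- :- (c :* ((:- k) :* g₁ :+ d :* g₁′)))
          :+ (:- (c :* d)) :* (g₁′ :- :- (c′ :* (d :* g₂)))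
          :+ (c :* d :* d :* g₂) :* (c′ :- (c :+ con 1ℚ))
          :+ (c :* (c :+ con 1ℚ) :* g₂) :* (d :* d :+ k :* k :- con 1ℚ)
          :+ (:- (c :* (c :+ con 1ℚ) :* k)) :* (k :* g₂ :- g₁)
          :+ (:- (c :* c)) :* (k :* g₁ :- g))
        S.refl (const γ) (const (γ + 1#)) cos ∂cos (sec^ γ) G₁ (∂ G₁) G₂ (∂ (∂ (sec^ γ)))))
    where
    G₁ G₂ : Series
    G₁ = sec^ (γ + 1#)
    G₂ = sec^ (γ + 1# + 1#)
    unfold : ∂ (∂ (sec^ γ)) ≋ ⊝ (const γ ⊛ ((⊝ cos) ⊛ G₁ ⊕ ∂cos ⊛ ∂ G₁))
    unfold n = begin
      ∂ (∂ (sec^ γ)) n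
        ≈⟨ ∂sec^ γ (suc n) ⟩
      - ∂ (const γ ⊛ (∂cos ⊛ G₁)) n
        ≈⟨ -‿cong (leibniz (const γ) (∂cos ⊛ G₁) n) ⟩
      - ((𝟘 ⊛ (∂cos ⊛ G₁)) n + (const γ ⊛ ∂ (∂cos ⊛ G₁)) n)
        ≈⟨ -‿cong (trans (+-congʳ (𝟘-⊛ (∂cos ⊛ G₁) n)) (+-identityˡ _)) ⟩
      - (const γ ⊛ ∂ (∂cos ⊛ G₁)) n
        ≈⟨ -‿cong (⊛-cong {const γ} (λ _ → refl) (leibniz ∂cos G₁) n) ⟩
      - (const γ ⊛ ((⊝ cos) ⊛ G₁ ⊕ ∂cos ⊛ ∂ G₁)) n ∎
      where open ≈-Reasoning setoid

  sec^-recurrence : ∀ γ n →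
    sec^ γ (suc (suc n)) ≈ γ * (γ + 1#) * sec^ (γ + 1# + 1#) n - γ * γ * sec^ γ n
  sec^-recurrence γ n = begin
    ∂ (∂ (sec^ γ)) n
      ≈⟨ ∂∂sec^ γ n ⟩
    (const γ ⊛ (const γ ⊕ 𝟙) ⊛ G₂ ⊖ const γ ⊛ const γ ⊛ sec^ γ) n
      ≈⟨ +-cong
           (⊛-cong {b = G₂} (λ m → trans (const-* γ (γ + 1#) m)
             (⊛-cong {const γ} (λ _ → refl) (const-suc γ) m)) (λ _ → refl) n)
           (-‿cong (⊛-cong {b = sec^ γ} (const-* γ γ) (λ _ → refl) n)) ⟨
    (const (γ * (γ + 1#)) ⊛ G₂ ⊖ const (γ * γ) ⊛ sec^ γ) n
      ≈⟨ +-cong (const-⊛ (γ * (γ + 1#)) G₂ n) (-‿cong (const-⊛ (γ * γ) (sec^ γ) n)) ⟩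
    γ * (γ + 1#) * G₂ n - γ * γ * sec^ γ n ∎
    where
    open ≈-Reasoning setoid
    G₂ = sec^ (γ + 1# + 1#)

-- Determinants as alternating forms on lists of columns.

module Determinant {c ℓ} (A : CommutativeℚAlgebra c ℓ) where
  open CommutativeℚAlgebra A hiding (zero)
  open Operations A
  open RationalSolver A
  open Range *-commutativeMonoid using () renaming (fold-last to ∏-last)
  open SemiringSum semiring using (*-distribˡ-sum; sum-cong-≋)
  open LinearCombination commutativeRing
  open ≈-Reasoning setoid

  -- Columns are infinite, of which `determinant n` reads the first n entries; deleting the top row
  -- is then simply `tail`.
  Column : Set c
  Column = ℕ → Carrier

  Form : Set c
  Form = List Column → Carrier

  tail : Column → Column
  tail v i = v (suc i)

  -- Contraction of an alternating form with the functional v ↦ v 0.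
  contract : Form → Form
  contract F []       = 0#
  contract F (v ∷ vs) = v 0 * F vs - contract (λ ws → F (v ∷ ws)) vs

  -- The value 0 on too long lists makes determinant zero alternating as well.
  determinant : ℕ → Form
  determinant zero    []      = 1#
  determinant zero    (_ ∷ _) = 0#
  determinant (suc n) vs      = contract (λ ws → determinant n (map tail ws)) vs

  contract-tabulate : ∀ {n} F (v : Vector Column (suc n)) → contract F (tabulate v) ≈
    sum (λ j → (- 1#) ^ toℕ j * v j 0 * F (tabulate (removeAt v j)))
  contract-tabulate {zero} F v = solve 2
    (λ x y → x :* y :- con 0ℚ := con 1ℚ :* x :* y :+ con 0ℚ) refl (v zero 0) (F [])
  contract-tabulate {suc n} F v = +-cong
    (*-congʳ (sym (*-identityˡ _)))
    (begin
      - contract F′ (tabulate (λ j → v (suc j)))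
        ≈⟨ -‿cong (contract-tabulate F′ (λ j → v (suc j))) ⟩
      - sum t
        ≈⟨ solve 1 (λ x → :- x := (:- con 1ℚ) :* x) refl (sum t) ⟩
      - 1# * sum t
        ≈⟨ *-distribˡ-sum (- 1#) t ⟩
      sum (λ j → - 1# * t j)
        ≈⟨ sum-cong-≋ {_} {λ j → - 1# * t j} (λ j →
             solve 4 (λ w x y z → w :* (x :* y :* z) := w :* x :* y :* z) refl _ _ _ _) ⟩
      sum (λ j → (- 1#) ^ toℕ (suc j) * v (suc j) 0 * F (tabulate (removeAt v (suc j)))) ∎)
    where
    F′ : Form
    F′ ws = F (v zero ∷ ws)
    t : Vector Carrier (suc n)
    t j = (- 1#) ^ toℕ j * v (suc j) 0 * F′ (tabulate (removeAt (λ i → v (suc i)) j))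

  det≈determinant : ∀ {n} (v : Vector Column n) →
    det (λ i j → v j (toℕ i)) ≈ determinant n (tabulate v)
  det≈determinant {zero}  v = refl
  det≈determinant {suc n} v = begin
    det (λ i j → v j (toℕ i))
      ≈⟨ sum-cong-≋ {_}
           {λ j → (- 1#) ^ toℕ j * v j 0 * det (λ i → removeAt (λ k → v k (suc (toℕ i))) j)}
           (λ j → *-congˡ (trans
             (det≈determinant (λ k → tail (removeAt v j k)))
             (reflexive (≡.cong (determinant n) (≡.sym (map-tabulate (removeAt v j) tail)))))) ⟩
    sum (λ j → (- 1#) ^ toℕ j * v j 0 * determinant n (map tail (tabulate (removeAt v j))))
      ≈⟨ contract-tabulate (λ ws → determinant n (map tail ws)) v ⟨
    determinant (suc n) (tabulate v) ∎

  -- Only adjacent equal columns are asked to give 0: this property passes directly through the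
  -- expansion along a row, and other positions follow from it by `swap`.
  record Alternating (F : Form) : Set (c ⊔ ℓ) where
    field
      linear : ∀ xs {u v w} a b ys → (∀ i → w i ≈ a * u i + b * v i) →
        F (xs ++ w ∷ ys) ≈ a * F (xs ++ u ∷ ys) + b * F (xs ++ v ∷ ys)
      repetition : ∀ xs u ys → F (xs ++ u ∷ u ∷ ys) ≈ 0#

  open Alternating

  insert-alternating : ∀ {F} v → Alternating F → Alternating (λ ws → F (v ∷ ws))
  insert-alternating v alt = record
    { linear     = λ xs → linear alt (v ∷ xs)
    ; repetition = λ xs → repetition alt (v ∷ xs)
    }

  map-alternating : ∀ {F} → Alternating F → Alternating (λ ws → F (map tail ws))
  map-alternating {F} alt = record
    { linear = λ xs {u} {v} {w} a b ys w≈ → begin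
        F (map tail (xs ++ w ∷ ys))
          ≡⟨ ≡.cong F (map-++ tail xs (w ∷ ys)) ⟩
        F (map tail xs ++ tail w ∷ map tail ys)
          ≈⟨ linear alt (map tail xs) a b (map tail ys) (λ i → w≈ (suc i)) ⟩
        a * F (map tail xs ++ tail u ∷ map tail ys) + b * F (map tail xs ++ tail v ∷ map tail ys)
          ≡⟨ ≡.cong₂ (λ x y → a * F x + b * F y) (map-++ tail xs (u ∷ ys)) (map-++ tail xs (v ∷ ys)) ⟨
        a * F (map tail (xs ++ u ∷ ys)) + b * F (map tail (xs ++ v ∷ ys)) ∎
    ; repetition = λ xs u ys → trans
        (reflexive (≡.cong F (map-++ tail xs (u ∷ u ∷ ys))))
        (repetition alt (map tail xs) (tail u) (map tail ys))
    }

  contract-linear : ∀ {F G H} a b → (∀ ws → F ws ≈ a * G ws + b * H ws) →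
    ∀ vs → contract F vs ≈ a * contract G vs + b * contract H vs
  contract-linear a b F≈ [] = solve 2 (λ a b → con 0ℚ := a :* con 0ℚ :+ b :* con 0ℚ) refl a b
  contract-linear {F} {G} {H} a b F≈ (v ∷ vs) = begin
    v 0 * F vs - contract (λ ws → F (v ∷ ws)) vs
      ≈⟨ +-cong (*-congˡ (F≈ vs)) (-‿cong (contract-linear a b (λ ws → F≈ (v ∷ ws)) vs)) ⟩
    v 0 * (a * G vs + b * H vs) - (a * contract (λ ws → G (v ∷ ws)) vs + b * contract (λ ws → H (v ∷ ws)) vs)
      ≈⟨ solve 7 (λ x a b g h k l → x :* (a :* g :+ b :* h) :- (a :* k :+ b :* l) :=
           a :* (x :* g :- k) :+ b :* (x :* h :- l)) refl (v 0) a b (G vs) (H vs) _ _ ⟩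
    a * contract G (v ∷ vs) + b * contract H (v ∷ vs) ∎

  contract-0 : ∀ {F} → (∀ ws → F ws ≈ 0#) → ∀ vs → contract F vs ≈ 0#
  contract-0 F≈0 []       = refl
  contract-0 F≈0 (v ∷ vs) = trans
    (+-cong (*-congˡ (F≈0 vs)) (-‿cong (contract-0 (λ ws → F≈0 (v ∷ ws)) vs)))
    (solve 1 (λ x → x :* con 0ℚ :- con 0ℚ := con 0ℚ) refl (v 0))

  -- The local lemmas quantify over F afresh, because stepping past a column replaces F by the form
  -- with that column inserted.
  contract-alternating : ∀ {F} → Alternating F → Alternating (contract F)
  contract-alternating alt = record { linear = contract-lin alt ; repetition = contract-rep alt }
    where
    contract-lin : ∀ {F} → Alternating F → ∀ xs {u v w} a b ys → (∀ i → w i ≈ a * u i + b * v i) →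
      contract F (xs ++ w ∷ ys) ≈ a * contract F (xs ++ u ∷ ys) + b * contract F (xs ++ v ∷ ys)
    contract-lin {F} alt [] {u} {v} {w} a b ys w≈ = begin
      w 0 * F ys - contract (λ ws → F (w ∷ ws)) ys
        ≈⟨ +-cong (*-congʳ (w≈ 0)) (-‿cong (contract-linear a b (λ ws → linear alt [] a b ws w≈) ys)) ⟩
      (a * u 0 + b * v 0) * F ys - (a * contract (λ ws → F (u ∷ ws)) ys + b * contract (λ ws → F (v ∷ ws)) ys)
        ≈⟨ solve 7 (λ a b x y f k l → (a :* x :+ b :* y) :* f :- (a :* k :+ b :* l) :=
             a :* (x :* f :- k) :+ b :* (y :* f :- l)) refl a b (u 0) (v 0) (F ys) _ _ ⟩
      a * contract F (u ∷ ys) + b * contract F (v ∷ ys) ∎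
    contract-lin {F} alt (x ∷ xs) {u} {v} {w} a b ys w≈ = begin
      x 0 * F (xs ++ w ∷ ys) - contract (λ ws → F (x ∷ ws)) (xs ++ w ∷ ys)
        ≈⟨ +-cong (*-congˡ (linear alt xs a b ys w≈))
             (-‿cong (contract-lin (insert-alternating x alt) xs a b ys w≈)) ⟩
      x 0 * (a * F (xs ++ u ∷ ys) + b * F (xs ++ v ∷ ys))
        - (a * contract (λ ws → F (x ∷ ws)) (xs ++ u ∷ ys) + b * contract (λ ws → F (x ∷ ws)) (xs ++ v ∷ ys))
        ≈⟨ solve 7 (λ x a b g h k l → x :* (a :* g :+ b :* h) :- (a :* k :+ b :* l) :=
             a :* (x :* g :- k) :+ b :* (x :* h :- l)) refl (x 0) a b _ _ _ _ ⟩
      a * contract F (x ∷ xs ++ u ∷ ys) + b * contract F (x ∷ xs ++ v ∷ ys) ∎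

    contract-rep : ∀ {F} → Alternating F → ∀ xs u ys → contract F (xs ++ u ∷ u ∷ ys) ≈ 0#
    -- The two terms that select one of the equal columns cancel; in all others both copies stay in
    -- the form.
    contract-rep {F} alt [] u ys = begin
      u 0 * F (u ∷ ys) - (u 0 * F (u ∷ ys) - contract (λ ws → F (u ∷ u ∷ ws)) ys)
        ≈⟨ solve 2 (λ x y → x :- (x :- y) := y) refl _ _ ⟩
      contract (λ ws → F (u ∷ u ∷ ws)) ys
        ≈⟨ contract-0 (repetition alt [] u) ys ⟩
      0# ∎
    contract-rep {F} alt (x ∷ xs) u ys = trans
      (+-cong (*-congˡ (repetition alt xs u ys)) (-‿cong (contract-rep (insert-alternating x alt) xs u ys)))
      (solve 1 (λ x → x :* con 0ℚ :- con 0ℚ := con 0ℚ) refl (x 0))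

  determinant-alternating : ∀ n → Alternating (determinant n)
  determinant-alternating zero = record
    { linear     = λ where
        []      a b ys _ → solve 2 (λ a b → con 0ℚ := a :* con 0ℚ :+ b :* con 0ℚ) refl a b
        (_ ∷ _) a b ys _ → solve 2 (λ a b → con 0ℚ := a :* con 0ℚ :+ b :* con 0ℚ) refl a b
    ; repetition = λ { [] u ys → refl ; (_ ∷ _) u ys → refl }
    }
  determinant-alternating (suc n) =
    contract-alternating (map-alternating (determinant-alternating n))

  -- Polarisation: F vanishes when its first two arguments are both u + w, both u, or both w.
  swap : ∀ {F} → Alternating F → ∀ u w ys → F (u ∷ w ∷ ys) ≈ - F (w ∷ u ∷ ys)
  swap {F} alt u w ys = combine₃ (- 1#) (- 1#) 1# (repetition alt [] u ys) (repetition alt [] w ys)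
    (begin
      1# * (1# * F (u ∷ u ∷ ys) + 1# * F (u ∷ w ∷ ys)) + 1# * (1# * F (w ∷ u ∷ ys) + 1# * F (w ∷ w ∷ ys))
        ≈⟨ +-cong (*-congˡ (linear alt [ u ] 1# 1# ys u+w)) (*-congˡ (linear alt [ w ] 1# 1# ys u+w)) ⟨
      1# * F (u ∷ s ∷ ys) + 1# * F (w ∷ s ∷ ys)
        ≈⟨ linear alt [] 1# 1# (s ∷ ys) u+w ⟨
      F (s ∷ s ∷ ys)
        ≈⟨ repetition alt [] s ys ⟩
      0# ∎)
    (solve 4 (λ p q r t → q := (:- r) :+ (:- con 1ℚ) :* (p :- con 0ℚ) :+ (:- con 1ℚ) :* (t :- con 0ℚ)
        :+ con 1ℚ :* (con 1ℚ :* (con 1ℚ :* p :+ con 1ℚ :* q) :+ con 1ℚ :* (con 1ℚ :* r :+ con 1ℚ :* t) :- con 0ℚ))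
      refl (F (u ∷ u ∷ ys)) (F (u ∷ w ∷ ys)) (F (w ∷ u ∷ ys)) (F (w ∷ w ∷ ys)))
    where
    s : Column
    s i = u i + w i
    u+w : ∀ i → s i ≈ 1# * u i + 1# * w i
    u+w i = sym (+-cong (*-identityˡ _) (*-identityˡ _))

  repetition-head : ∀ {F} → Alternating F → ∀ u ys zs → F (u ∷ ys ++ u ∷ zs) ≈ 0#
  repetition-head alt u []       zs = repetition alt [] u zs
  repetition-head {F} alt u (y ∷ ys) zs = begin
    F (u ∷ y ∷ ys ++ u ∷ zs)     ≈⟨ swap alt u y (ys ++ u ∷ zs) ⟩
    - F (y ∷ u ∷ ys ++ u ∷ zs)   ≈⟨ -‿cong (repetition-head (insert-alternating y alt) u ys zs) ⟩
    - 0#                         ≈⟨ solve 0 (:- con 0ℚ := con 0ℚ) refl ⟩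
    0#                           ∎

  repetition-∈ : ∀ {F} → Alternating F → ∀ {u xs} → u ∈ xs → ∀ zs → F (xs ++ u ∷ zs) ≈ 0#
  repetition-∈ alt {xs = x ∷ xs} (here ≡.refl) zs = repetition-head alt x xs zs
  repetition-∈ alt {xs = x ∷ xs} (there u∈xs)  zs = repetition-∈ (insert-alternating x alt) u∈xs zs

  data Span (xs : List Column) : Column → Set (c ⊔ ℓ) where
    null    : ∀ {v} → (∀ i → v i ≈ 0#) → Span xs v
    combine : ∀ {u v w} a → u ∈ xs → Span xs w → (∀ i → v i ≈ a * u i + w i) → Span xs v

  span-kills : ∀ {F} → Alternating F → ∀ {xs v} → Span xs v → ∀ ys → F (xs ++ v ∷ ys) ≈ 0#
  span-kills {F} alt {xs} {v} (null v≈0) ys = begin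
    F (xs ++ v ∷ ys)
      ≈⟨ linear alt xs {v} {v} 0# 0# ys (λ i → trans (v≈0 i)
           (solve 1 (λ x → con 0ℚ := con 0ℚ :* x :+ con 0ℚ :* x) refl (v i))) ⟩
    0# * F (xs ++ v ∷ ys) + 0# * F (xs ++ v ∷ ys)
      ≈⟨ solve 1 (λ x → con 0ℚ :* x :+ con 0ℚ :* x := con 0ℚ) refl _ ⟩
    0# ∎
  span-kills {F} alt {xs} {v} (combine {u} {w = w} a u∈xs w∈xs v≈) ys = begin
    F (xs ++ v ∷ ys)
      ≈⟨ linear alt xs a 1# ys (λ i → trans (v≈ i) (+-congˡ (sym (*-identityˡ _)))) ⟩
    a * F (xs ++ u ∷ ys) + 1# * F (xs ++ w ∷ ys)
      ≈⟨ +-cong (*-congˡ (repetition-∈ alt u∈xs ys)) (*-congˡ (span-kills alt w∈xs ys)) ⟩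
    a * 0# + 1# * 0#
      ≈⟨ solve 1 (λ a → a :* con 0ℚ :+ con 1ℚ :* con 0ℚ := con 0ℚ) refl a ⟩
    0# ∎

  -- The columns f k, ..., f (k + m - 1). Those not yet processed, behind a prefix of length k, keep
  -- their original indices.
  range : (ℕ → Column) → ℕ → ℕ → List Column
  range f k zero    = []
  range f k (suc m) = f k ∷ range f (suc k) m

  range-suc : ∀ f k m → range f (suc k) m ≡ range (λ j → f (suc j)) k m
  range-suc f k zero    = ≡.refl
  range-suc f k (suc m) = ≡.cong (f (suc k) ∷_) (range-suc f (suc k) m)

  tabulate-range : ∀ n f → tabulate {n = n} (λ j → f (toℕ j)) ≡ range f 0 n
  tabulate-range zero    f = ≡.refl
  tabulate-range (suc n) f = ≡.cong (f 0 ∷_)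
    (≡.trans (tabulate-range n (λ j → f (suc j))) (≡.sym (range-suc f 0 n)))

  module _ {F} (alt : Alternating F) (e v w : ℕ → Column) (κ : ℕ → Carrier)
    (w∈e : ∀ j → Span (applyUpTo e j) (w j))
    (v≈κe+w : ∀ j i → v j i ≈ κ j * e j i + w j i) where

    -- Columns are replaced from the left. When `v k` is reached, everything before it is already e
    -- 0, ..., e (k - 1); the remainder `w k` lies in their span and contributes 0.
    triangular-step : ∀ k m → F (applyUpTo e k ++ range v k (suc m)) ≈
      κ k * F (applyUpTo e (suc k) ++ range v (suc k) m)
    triangular-step k m = begin
      F (applyUpTo e k ++ v k ∷ rest)
        ≈⟨ linear alt (applyUpTo e k) (κ k) 1# rest
             (λ i → trans (v≈κe+w k i) (+-congˡ (sym (*-identityˡ _)))) ⟩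
      κ k * F (applyUpTo e k ++ e k ∷ rest) + 1# * F (applyUpTo e k ++ w k ∷ rest)
        ≈⟨ +-congˡ (*-congˡ (span-kills alt (w∈e k) rest)) ⟩
      κ k * F (applyUpTo e k ++ e k ∷ rest) + 1# * 0#
        ≈⟨ solve 1 (λ x → x :+ con 1ℚ :* con 0ℚ := x) refl _ ⟩
      κ k * F (applyUpTo e k ++ e k ∷ rest)
        ≡⟨ ≡.cong (λ z → κ k * F z) (≡.trans
             (≡.sym (++-assoc (applyUpTo e k) [ e k ] rest))
             (≡.cong (_++ rest) (applyUpTo-∷ʳ e k))) ⟩
      κ k * F (applyUpTo e (suc k) ++ rest) ∎
      where rest = range v (suc k) m

    triangular-steps : ∀ k m → F (range v 0 (k ℕ.+ m)) ≈
      ∏< k κ * F (applyUpTo e k ++ range v k m)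
    triangular-steps zero    m = sym (*-identityˡ _)
    triangular-steps (suc k) m = begin
      F (range v 0 (suc k ℕ.+ m))
        ≡⟨ ≡.cong (λ n → F (range v 0 n)) (ℕ.+-suc k m) ⟨
      F (range v 0 (k ℕ.+ suc m))
        ≈⟨ triangular-steps k (suc m) ⟩
      ∏< k κ * F (applyUpTo e k ++ range v k (suc m))
        ≈⟨ *-congˡ (triangular-step k m) ⟩
      ∏< k κ * (κ k * F (applyUpTo e (suc k) ++ range v (suc k) m))
        ≈⟨ *-assoc _ _ _ ⟨
      ∏< k κ * κ k * F (applyUpTo e (suc k) ++ range v (suc k) m)
        ≈⟨ *-congʳ (∏-last k κ) ⟨
      ∏< (suc k) κ * F (applyUpTo e (suc k) ++ range v (suc k) m) ∎

    triangular : ∀ n → F (tabulate {n = n} (λ j → v (toℕ j))) ≈ ∏< n κ * F (applyUpTo e n)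
    triangular n = begin
      F (tabulate {n = n} (λ j → v (toℕ j)))
        ≡⟨ ≡.cong F (≡.trans (tabulate-range n v) (≡.cong (range v 0) (≡.sym (ℕ.+-identityʳ n)))) ⟩
      F (range v 0 (n ℕ.+ 0))
        ≈⟨ triangular-steps n 0 ⟩
      ∏< n κ * F (applyUpTo e n ++ [])
        ≡⟨ ≡.cong (λ z → ∏< n κ * F z) (++-identityʳ (applyUpTo e n)) ⟩
      ∏< n κ * F (applyUpTo e n) ∎

-- Polynomial functions with a recorded leading coefficient.

module Polynomials {c ℓ} (A : CommutativeℚAlgebra c ℓ) where
  open CommutativeℚAlgebra A hiding (zero)
  open Operations A
  open RationalSolver A
  open ≈-Reasoning setoid

  -- Poly d a p: p is a polynomial function of degree at most d, a being its
  -- coefficient in degree d.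
  data Poly : ℕ → Carrier → (Carrier → Carrier) → Set (c ⊔ ℓ) where
    constant : ∀ {a p} → (∀ x → p x ≈ a) → Poly 0 a p
    horner   : ∀ {d a p} k {q} → Poly d a q → (∀ x → p x ≈ k + x * q x) → Poly (suc d) a p

  poly-cong : ∀ {d a b p q} → a ≈ b → (∀ x → q x ≈ p x) → Poly d a p → Poly d b q
  poly-cong a≈b q≈p (constant p≈a)   = constant (λ x → trans (q≈p x) (trans (p≈a x) a≈b))
  poly-cong a≈b q≈p (horner k r p≈)  =
    horner k (poly-cong a≈b (λ _ → refl) r) (λ x → trans (q≈p x) (p≈ x))

  poly-+ : ∀ {d a b p q} → Poly d a p → Poly d b q → Poly d (a + b) (λ x → p x + q x)
  poly-+ (constant p≈a) (constant q≈b) = constant (λ x → +-cong (p≈a x) (q≈b x))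
  poly-+ (horner k p p≈) (horner l q q≈) = horner (k + l) (poly-+ p q) λ x → trans
    (+-cong (p≈ x) (q≈ x))
    (solve 5 (λ k l x p q → k :+ x :* p :+ (l :+ x :* q) := k :+ l :+ x :* (p :+ q)) refl k l x _ _)

  poly-scale : ∀ {d a p} y → Poly d a p → Poly d (y * a) (λ x → y * p x)
  poly-scale y (constant p≈a)  = constant (λ x → *-congˡ (p≈a x))
  poly-scale y (horner k p p≈) = horner (y * k) (poly-scale y p) λ x → trans
    (*-congˡ (p≈ x))
    (solve 4 (λ y k x p → y :* (k :+ x :* p) := y :* k :+ x :* (y :* p)) refl y k x _)

  poly-raise : ∀ {d a p} → Poly d a p → Poly (suc d) 0# p
  poly-raise {a = a} (constant p≈a) = horner a {λ _ → 0#} (constant (λ _ → refl)) λ x → trans (p≈a x)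
    (solve 2 (λ a x → a := a :+ x :* con 0ℚ) refl a x)
  poly-raise (horner k p p≈) = horner k (poly-raise p) p≈

  poly-+-raise : ∀ {d a b p q} → Poly (suc d) a p → Poly d b q → Poly (suc d) a (λ x → p x + q x)
  poly-+-raise p q = poly-cong (+-identityʳ _) (λ _ → refl) (poly-+ p (poly-raise q))

  -- Synthetic division: if p(x) = k + x q(x) and q(x) = q(y) + (x - y) r(x), then p(x) - p(y) = (x
  -- - y) (q(x) + y r(x)). The leading coefficient persists because r has a smaller degree bound
  -- than q.
  poly-divide : ∀ {d a p} → Poly (suc d) a p → ∀ y →
    ∃[ q ] (Poly d a q & (∀ x → p x ≈ p y + (x - y) * q x))
  poly-divide {zero} {a} {p} (horner k {q} (constant q≈a) p≈) y =
    (λ _ → a) , constant (λ _ → refl) , λ x → begin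
      p x                            ≈⟨ trans (p≈ x) (+-congˡ (*-congˡ (q≈a x))) ⟩
      k + x * a                      ≈⟨ solve 4 (λ k a x y → k :+ x :* a := k :+ y :* a :+ (x :- y) :* a) refl k a x y ⟩
      k + y * a + (x - y) * a        ≈⟨ +-congʳ (trans (p≈ y) (+-congˡ (*-congˡ (q≈a y)))) ⟨
      p y + (x - y) * a              ∎
  poly-divide {suc d} {a} {p} (horner k {q} polyq p≈) y with poly-divide polyq y
  ... | r , polyr , q≈ = (λ x → q x + y * r x) , poly-+-raise polyq (poly-scale y polyr) , λ x → begin
      p x
        ≈⟨ p≈ x ⟩
      k + x * q x
        ≈⟨ solve 4 (λ k x y q → k :+ x :* q := k :+ y :* q :+ (x :- y) :* q) refl k x y (q x) ⟩
      k + y * q x + (x - y) * q x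
        ≈⟨ +-congʳ (+-congˡ (*-congˡ (q≈ x))) ⟩
      k + y * (q y + (x - y) * r x) + (x - y) * q x
        ≈⟨ solve 6 (λ k x y u v r → k :+ y :* (v :+ (x :- y) :* r) :+ (x :- y) :* u
             := k :+ y :* v :+ (x :- y) :* (u :+ y :* r)) refl k x y (q x) (q y) (r x) ⟩
      k + y * q y + (x - y) * (q x + y * r x)
        ≈⟨ +-congʳ (p≈ y) ⟨
      p y + (x - y) * (q x + y * r x) ∎

  poly-shift : ∀ {d a p} → Poly d a p → Poly d a (λ x → p (x + 1# + 1#))
  poly-shift (constant p≈a) = constant (λ x → p≈a _)
  poly-shift {suc d} {a} {p} (horner k {q} polyq p≈) =
    poly-cong refl expand (poly-+-raise
      (horner k (poly-shift polyq) (λ _ → refl)) (poly-scale (1# + 1#) (poly-shift polyq)))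
    where
    expand : ∀ x → p (x + 1# + 1#) ≈ k + x * q (x + 1# + 1#) + (1# + 1#) * q (x + 1# + 1#)
    expand x = trans (p≈ _) (solve 3 (λ k x q → k :+ (x :+ con 1ℚ :+ con 1ℚ) :* q
      := k :+ x :* q :+ (con 1ℚ :+ con 1ℚ) :* q) refl k x _)

  -- For p(x) = k + x q(x) the difference is x (q(x+2) - q(x)) + 2 q(x+2), so each further degree
  -- adds 2a to the leading coefficient.
  poly-Δ : ∀ {d a p} → Poly (suc d) a p →
    Poly d ((1# + 1#) * nat (suc d) * a) (λ x → p (x + 1# + 1#) - p x)
  poly-Δ {zero} {a} {p} (horner k {q} (constant q≈a) p≈) = constant λ x → begin
    p (x + 1# + 1#) - p x
      ≈⟨ +-cong (trans (p≈ _) (+-congˡ (*-congˡ (q≈a _)))) (-‿cong (trans (p≈ x) (+-congˡ (*-congˡ (q≈a x))))) ⟩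
    k + (x + 1# + 1#) * a - (k + x * a)
      ≈⟨ solve 3 (λ k x a → k :+ (x :+ con 1ℚ :+ con 1ℚ) :* a :- (k :+ x :* a)
           := (con 1ℚ :+ con 1ℚ) :* (con 1ℚ :+ con 0ℚ) :* a) refl k x a ⟩
    (1# + 1#) * nat 1 * a ∎
  poly-Δ {suc d} {a} {p} (horner k {q} polyq p≈) = poly-cong
    (solve 2 (λ n a → (con 1ℚ :+ con 1ℚ) :* n :* a :+ (con 1ℚ :+ con 1ℚ) :* a
      := (con 1ℚ :+ con 1ℚ) :* (con 1ℚ :+ n) :* a) refl (nat (suc d)) a)
    expand
    (poly-+ (horner 0# (poly-Δ polyq) (λ _ → refl)) (poly-scale (1# + 1#) (poly-shift polyq)))
    where
    expand : ∀ x → p (x + 1# + 1#) - p x ≈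
      0# + x * (q (x + 1# + 1#) - q x) + (1# + 1#) * q (x + 1# + 1#)
    expand x = trans (+-cong (p≈ _) (-‿cong (p≈ x)))
      (solve 4 (λ k x q r → k :+ (x :+ con 1ℚ :+ con 1ℚ) :* q :- (k :+ x :* r)
        := con 0ℚ :+ x :* (q :- r) :+ (con 1ℚ :+ con 1ℚ) :* q) refl k x _ _)

-- Vandermonde determinants for arbitrary polynomials of degrees 0, 1, 2, ...

module Vandermonde {c ℓ} (A : CommutativeℚAlgebra c ℓ) where
  open CommutativeℚAlgebra A hiding (zero)
  open Operations A
  open RationalSolver A
  open Polynomials A
  open Determinant A
  open Alternating
  open ≈-Reasoning setoid

  differences : Carrier → List Carrier → Carrier
  differences x []       = 1#
  differences x (y ∷ ys) = (y - x) * differences x ys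

  vandermonde : List Carrier → Carrier
  vandermonde []       = 1#
  vandermonde (x ∷ xs) = differences x xs * vandermonde xs

  -- In the application u is the column of x₀, which the form already contains, so u is killed in
  -- every position. Each other column becomes x - x₀ times its divided difference.
  extract-differences : ∀ {F} → Alternating F → ∀ x₀ u (v w : Carrier → Column) →
    (∀ pre post → F (pre ++ u ∷ post) ≈ 0#) →
    (∀ x i → v x i ≈ (x - x₀) * w x i + 1# * u i) →
    ∀ xs → F (map v xs) ≈ differences x₀ xs * F (map w xs)
  extract-differences alt x₀ u v w F[u]≈0 v≈ [] = sym (*-identityˡ _)
  extract-differences {F} alt x₀ u v w F[u]≈0 v≈ (x ∷ xs) = begin
    F (v x ∷ map v xs)
      ≈⟨ linear alt [] (x - x₀) 1# (map v xs) (v≈ x) ⟩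
    (x - x₀) * F (w x ∷ map v xs) + 1# * F (u ∷ map v xs)
      ≈⟨ +-cong
           (*-congˡ (extract-differences (insert-alternating (w x) alt) x₀ u v w
             (λ pre → F[u]≈0 (w x ∷ pre)) v≈ xs))
           (*-congˡ (F[u]≈0 [] (map v xs))) ⟩
    (x - x₀) * (differences x₀ xs * F (w x ∷ map w xs)) + 1# * 0#
      ≈⟨ solve 3 (λ d e f → d :* (e :* f) :+ con 1ℚ :* con 0ℚ := d :* e :* f) refl (x - x₀) _ _ ⟩
    differences x₀ (x ∷ xs) * F (map w (x ∷ xs)) ∎

  contract-heads≈0 : ∀ F (w : Carrier → Column) → (∀ x → w x 0 ≈ 0#) →
    ∀ xs → contract F (map w xs) ≈ 0#
  contract-heads≈0 F w w₀≈0 []       = refl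
  contract-heads≈0 F w w₀≈0 (x ∷ xs) = begin
    w x 0 * F (map w xs) - contract (λ ws → F (w x ∷ ws)) (map w xs)
      ≈⟨ +-cong (*-congʳ (w₀≈0 x)) (-‿cong (contract-heads≈0 (λ ws → F (w x ∷ ws)) w w₀≈0 xs)) ⟩
    0# * F (map w xs) - 0#
      ≈⟨ solve 1 (λ f → con 0ℚ :* f :- con 0ℚ := con 0ℚ) refl _ ⟩
    0# ∎

  -- Pass from the columns of the remaining nodes to divided differences at x₀. Their top entry is
  -- 0, since `p 0` is constant, so the first row leaves a smaller determinant of the quotients,
  -- with the leading coefficients moved up by one. The quotients depend on x₀, hence the induction
  -- ranges over all families p.
  determinant-polynomials : (p : ℕ → Carrier → Carrier) (a : ℕ → Carrier) →
    (∀ i → Poly i (a i) (p i)) → ∀ xs →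
    determinant (length xs) (map (λ x i → p i x) xs) ≈ ∏< (length xs) a * vandermonde xs
  determinant-polynomials p a poly []        = sym (*-identityˡ _)
  determinant-polynomials p a poly (x₀ ∷ xs) = begin
    F (v x₀ ∷ map v xs)
      ≈⟨ extract-differences (insert-alternating (v x₀) altF) x₀ (v x₀) v w
           (λ pre post → repetition-head altF (v x₀) pre post) v≈ xs ⟩
    differences x₀ xs
      * (p 0 x₀ * determinant n (map tail (map w xs)) - contract (λ ws → G (v x₀ ∷ ws)) (map w xs))
      ≈⟨ *-congˡ (+-cong
           (*-cong (leading poly₀)
             (trans (reflexive (≡.cong (determinant n) (≡.sym (map-∘ xs))))
               (determinant-polynomials q (λ i → a (suc i)) (λ i → proj₁ (proj₂ (quotient i))) xs)))
           (-‿cong (contract-heads≈0 (λ ws → G (v x₀ ∷ ws)) w (λ _ → refl) xs))) ⟩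
    differences x₀ xs * (a 0 * (∏< n (λ i → a (suc i)) * vandermonde xs) - 0#)
      ≈⟨ solve 4 (λ d a b e → d :* (a :* (b :* e) :- con 0ℚ) := a :* b :* (d :* e)) refl
           (differences x₀ xs) (a 0) (∏< n (λ i → a (suc i))) (vandermonde xs) ⟩
    ∏< (suc n) a * vandermonde (x₀ ∷ xs) ∎
    where
    n = length xs
    F G : Form
    F = determinant (suc n)
    G ws = determinant n (map tail ws)
    altF = determinant-alternating (suc n)
    quotient : ∀ i → ∃[ q ] (Poly i (a (suc i)) q & (∀ x → p (suc i) x ≈ p (suc i) x₀ + (x - x₀) * q x))
    quotient i = poly-divide (poly (suc i)) x₀
    q : ℕ → Carrier → Carrier
    q i = proj₁ (quotient i)
    v w : Carrier → Column
    v x i       = p i x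
    w x zero    = 0#
    w x (suc i) = q i x
    poly₀ = poly 0
    leading : ∀ {b r} → Poly 0 b r → ∀ {x} → r x ≈ b
    leading (constant r≈b) = r≈b _
    v≈ : ∀ x i → v x i ≈ (x - x₀) * w x i + 1# * v x₀ i
    v≈ x zero = trans (leading poly₀) (trans (sym (leading poly₀))
      (solve 2 (λ d y → y := d :* con 0ℚ :+ con 1ℚ :* y) refl (x - x₀) (p 0 x₀)))
    v≈ x (suc i) = trans (proj₂ (proj₂ (quotient i)) x)
      (solve 2 (λ y z → y :+ z := z :+ con 1ℚ :* y) refl _ _)

-- Even derivatives of sec^γ at 0 as polynomials in γ.

module SecantPolynomials {c ℓ} (A : CommutativeℚAlgebra c ℓ) where
  open CommutativeℚAlgebra A hiding (zero)
  open Operations A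
  open RationalSolver A
  open Polynomials A
  open SecantPowers A
  open Scalars A using (nat-*)

  evenSec : ℕ → Carrier → Carrier
  evenSec i γ = sec^ γ (2 ℕ.* i)

  -- The double factorial (2i - 1)!!.
  oddFactorial : ℕ → Carrier
  oddFactorial zero    = 1#
  oddFactorial (suc i) = nat (suc (2 ℕ.* i)) * oddFactorial i

  evenSec-recurrence : ∀ i γ → evenSec (suc i) γ ≈
    γ * (γ + 1#) * evenSec i (γ + 1# + 1#) - γ * γ * evenSec i γ
  evenSec-recurrence i γ = trans
    (reflexive (≡.cong (sec^ γ) (ℕ.*-suc 2 i)))
    (sec^-recurrence γ (2 ℕ.* i))

  -- Regroup the recurrence as γ (γ (E(γ+2) - E(γ)) + E(γ+2)). The difference loses a degree, so the
  -- total gains only one, and the leading coefficient a becomes 2 (d+1) a + a = (2d+3) a.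
  evenSec-poly-suc : ∀ d → Poly (suc d) (oddFactorial (suc d)) (evenSec (suc d)) →
    Poly (suc (suc d)) (oddFactorial (suc (suc d))) (evenSec (suc (suc d)))
  evenSec-poly-suc d E = horner 0#
    (poly-cong leading (λ _ → refl)
      (poly-+ (horner 0# (poly-Δ E) (λ _ → refl)) (poly-shift E)))
    λ x → trans (evenSec-recurrence (suc d) x)
      (solve 3 (λ x u v → x :* (x :+ con 1ℚ) :* u :- x :* x :* v
        := con 0ℚ :+ x :* (con 0ℚ :+ x :* (u :- v) :+ u)) refl x _ _)
    where
    a = oddFactorial (suc d)
    leading : (1# + 1#) * nat (suc d) * a + a ≈ oddFactorial (suc (suc d))
    leading = trans
      (solve 2 (λ n a → (con 1ℚ :+ con 1ℚ) :* n :* a :+ a :=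
        (con 1ℚ :+ (con 1ℚ :+ (con 1ℚ :+ con 0ℚ)) :* n) :* a) refl (nat (suc d)) a)
      (*-congʳ (+-congˡ (sym (nat-* 2 (suc d)))))

  evenSec-poly : ∀ i → Poly i (oddFactorial i) (evenSec i)
  evenSec-poly zero          = constant sec^-zero
  -- Separate because `poly-Δ` starts from positive degree; the polynomial is γ itself.
  evenSec-poly (suc zero)    = horner 0# {λ _ → nat 1 * 1#} (constant (λ _ → refl)) λ x → trans
    (evenSec-recurrence 0 x)
    (trans (+-cong (*-congˡ (sec^-zero (x + 1# + 1#))) (-‿cong (*-congˡ (sec^-zero x))))
      (solve 1 (λ x → x :* (x :+ con 1ℚ) :* con 1ℚ :- x :* x :* con 1ℚ
        := con 0ℚ :+ x :* ((con 1ℚ :+ con 0ℚ) :* con 1ℚ)) refl x))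
  evenSec-poly (suc (suc d)) = evenSec-poly-suc d (evenSec-poly (suc d))

-- Halving, and products of signs, factorials and rectangular arrays.

⌈n/2⌉≡⌊n/2⌋⊎1+⌊n/2⌋ : ∀ n → ⌈ n /2⌉ ≡ ⌊ n /2⌋ ⊎ ⌈ n /2⌉ ≡ suc ⌊ n /2⌋
⌈n/2⌉≡⌊n/2⌋⊎1+⌊n/2⌋ zero          = inj₁ ≡.refl
⌈n/2⌉≡⌊n/2⌋⊎1+⌊n/2⌋ (suc zero)    = inj₂ ≡.refl
⌈n/2⌉≡⌊n/2⌋⊎1+⌊n/2⌋ (suc (suc n)) with ⌈n/2⌉≡⌊n/2⌋⊎1+⌊n/2⌋ n
... | inj₁ eq = inj₁ (≡.cong suc eq)
... | inj₂ eq = inj₂ (≡.cong suc eq)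

⌊2*n/2⌋≡n : ∀ n → ⌊ 2 ℕ.* n /2⌋ ≡ n
⌊2*n/2⌋≡n n = ≡.trans (≡.cong (λ k → ⌊ n ℕ.+ k /2⌋) (ℕ.+-identityʳ n)) (≡.sym (ℕ.n≡⌊n+n/2⌋ n))

⌈2*n/2⌉≡n : ∀ n → ⌈ 2 ℕ.* n /2⌉ ≡ n
⌈2*n/2⌉≡n n = ≡.trans (≡.cong (λ k → ⌈ n ℕ.+ k /2⌉) (ℕ.+-identityʳ n)) (≡.sym (ℕ.n≡⌈n+n/2⌉ n))

module Products {c ℓ} (A : CommutativeℚAlgebra c ℓ) where
  open CommutativeℚAlgebra A hiding (zero)
  open Operations A
  open RationalSolver A
  open Scalars A
  open Exp semiring using (^-homo-*)
  open Range *-commutativeMonoid public using () renaming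
    ( fold-cong to ∏-cong; fold-last to ∏-last; fold-∙ to ∏-*; fold-ε to ∏-1
    ; fold-parity to ∏-parity)
  open ≈-Reasoning setoid

  superfactorial : ℕ → Carrier
  superfactorial n = ∏< n (λ i → nat (i !))

  ∏-scale : ∀ n x f → ∏< n (λ k → x * f k) ≈ x ^ n * ∏< n f
  ∏-scale zero    x f = sym (*-identityˡ _)
  ∏-scale (suc n) x f = trans (*-congˡ (∏-scale n x (λ k → f (suc k))))
    (solve 4 (λ x y z w → x :* y :* (z :* w) := x :* z :* (y :* w)) refl x (f 0) (x ^ n) _)

  ^-double : ∀ x n → x ^ (2 ℕ.* n) ≈ x ^ n * x ^ n
  ^-double x n = trans (reflexive (≡.cong (λ k → x ^ (n ℕ.+ k)) (ℕ.+-identityʳ n))) (^-homo-* x n n)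

  ∏-even : ∀ l f → ∏< (2 ℕ.* l) f ≈ ∏< l (λ k → f (2 ℕ.* k)) * ∏< l (λ k → f (suc (2 ℕ.* k)))
  ∏-even l f = trans (∏-parity (2 ℕ.* l) f) (reflexive (≡.cong₂
    (λ p q → ∏< p (λ k → f (2 ℕ.* k)) * ∏< q (λ k → f (suc (2 ℕ.* k)))) (⌈2*n/2⌉≡n l) (⌊2*n/2⌋≡n l)))

  ∏-odd : ∀ l f → ∏< (suc (2 ℕ.* l)) f ≈
    ∏< (suc l) (λ k → f (2 ℕ.* k)) * ∏< l (λ k → f (suc (2 ℕ.* k)))
  ∏-odd l f = trans (∏-parity (suc (2 ℕ.* l)) f) (reflexive (≡.cong₂
    (λ p q → ∏< p (λ k → f (2 ℕ.* k)) * ∏< q (λ k → f (suc (2 ℕ.* k))))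
    (≡.cong suc (⌊2*n/2⌋≡n l)) (⌈2*n/2⌉≡n l)))

  ∏-sign : ∀ p → ∏< p (λ l → (- 1#) ^ l) ≈ (- 1#) ^ (p C 2)
  ∏-sign zero    = refl
  ∏-sign (suc p) = begin
    ∏< (suc p) (λ l → (- 1#) ^ l)        ≈⟨ ∏-last p (λ l → (- 1#) ^ l) ⟩
    ∏< p (λ l → (- 1#) ^ l) * (- 1#) ^ p ≈⟨ *-congʳ (∏-sign p) ⟩
    (- 1#) ^ (p C 2) * (- 1#) ^ p        ≈⟨ *-comm _ _ ⟩
    (- 1#) ^ p * (- 1#) ^ (p C 2)        ≈⟨ ^-homo-* (- 1#) p (p C 2) ⟨
    (- 1#) ^ (p ℕ.+ p C 2)               ≡⟨ ≡.cong ((- 1#) ^_) (≡.trans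
                                              (≡.cong (ℕ._+ p C 2) (≡.sym (nC1≡n p)))
                                              (nCk+nC[k+1]≡[n+1]C[k+1] p 1)) ⟩
    (- 1#) ^ (suc p C 2)                 ∎

  ∏-nat-nat : ∀ l → ∏< l (λ k → nat l - nat k) ≈ nat (l !)
  ∏-nat-nat zero    = sym (+-identityʳ 1#)
  ∏-nat-nat (suc l) = begin
    (nat (suc l) - 0#) * ∏< l (λ k → nat (suc l) - nat (suc k))
      ≈⟨ *-cong (solve 1 (λ x → x :- con 0ℚ := x) refl _)
           (∏-cong l {λ k → nat (suc l) - nat (suc k)}
             (λ k → solve 2 (λ x y → con 1ℚ :+ x :- (con 1ℚ :+ y) := x :- y) refl (nat l) (nat k))) ⟩
    nat (suc l) * ∏< l (λ k → nat l - nat k)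
      ≈⟨ *-congˡ (∏-nat-nat l) ⟩
    nat (suc l) * nat (l !)
      ≈⟨ nat-* (suc l) (l !) ⟨
    nat (suc l !) ∎

  ∏-falling : ∀ q p → ∏< q (λ c → nat (suc (q ℕ.+ p ∸ suc c))) * nat (p !) ≈ nat ((q ℕ.+ p) !)
  ∏-falling zero    p = *-identityˡ _
  ∏-falling (suc q) p = begin
    nat (suc (q ℕ.+ p)) * ∏< q (λ c → nat (suc (q ℕ.+ p ∸ suc c))) * nat (p !)
      ≈⟨ *-assoc _ _ _ ⟩
    nat (suc (q ℕ.+ p)) * (∏< q (λ c → nat (suc (q ℕ.+ p ∸ suc c))) * nat (p !))
      ≈⟨ *-congˡ (∏-falling q p) ⟩
    nat (suc (q ℕ.+ p)) * nat ((q ℕ.+ p) !)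
      ≈⟨ nat-* (suc (q ℕ.+ p)) ((q ℕ.+ p) !) ⟨
    nat ((suc q ℕ.+ p) !) ∎

  rectangle : ℕ → ℕ → (ℕ → ℕ → Carrier) → Carrier
  rectangle p q y = ∏< p (λ r → ∏< q (λ c → y r c))

  rectangle-* : ∀ p q x y → rectangle p q (λ r c → x r c * y r c) ≈ rectangle p q x * rectangle p q y
  rectangle-* p q x y = trans
    (∏-cong p {g = λ r → ∏< q (x r) * ∏< q (y r)} (λ r → ∏-* q (x r) (y r)))
    (∏-* p (λ r → ∏< q (x r)) (λ r → ∏< q (y r)))

  -- Row r, counted from 0, is (p+q-1-r)! / (p-1-r)!. Over all rows the numerators give the
  -- superfactorial of p + q divided by that of q, and the denominators give that of p.
  superfactorial-+ : ∀ p q →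
    rectangle p q (λ r c → nat (suc (p ℕ.+ q ∸ suc r ∸ suc c))) * (superfactorial p * superfactorial q)
      ≈ superfactorial (p ℕ.+ q)
  superfactorial-+ zero    q = trans (*-identityˡ _) (*-identityˡ _)
  superfactorial-+ (suc p) q = begin
    row * rect * (superfactorial (suc p) * superfactorial q)
      ≈⟨ *-congˡ (*-congʳ (∏-last p (λ i → nat (i !)))) ⟩
    row * rect * (superfactorial p * nat (p !) * superfactorial q)
      ≈⟨ solve 5 (λ a b c d e → a :* b :* (c :* d :* e) := (b :* (c :* e)) :* (a :* d)) refl
           row rect (superfactorial p) (nat (p !)) (superfactorial q) ⟩
    rect * (superfactorial p * superfactorial q) * (row * nat (p !))
      ≈⟨ *-cong (superfactorial-+ p q) row-factorial ⟩
    superfactorial (p ℕ.+ q) * nat ((p ℕ.+ q) !)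
      ≈⟨ ∏-last (p ℕ.+ q) (λ i → nat (i !)) ⟨
    superfactorial (suc p ℕ.+ q) ∎
    where
    row  = ∏< q (λ c → nat (suc (p ℕ.+ q ∸ suc c)))
    rect = rectangle p q (λ r c → nat (suc (p ℕ.+ q ∸ suc r ∸ suc c)))
    row-factorial : row * nat (p !) ≈ nat ((p ℕ.+ q) !)
    row-factorial = ≡.subst
      (λ n → ∏< q (λ c → nat (suc (n ∸ suc c))) * nat (p !) ≈ nat (n !))
      (ℕ.+-comm q p) (∏-falling q p)

  superfactorial-÷ : ∀ p q → superfactorial p * superfactorial q ≈
    superfactorial (p ℕ.+ q) * rectangle p q (λ r c → ι (+ 1 / suc (p ℕ.+ q ∸ suc r ∸ suc c)))
  superfactorial-÷ p q = begin
    sfs                     ≈⟨ *-identityˡ _ ⟨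
    1# * sfs                ≈⟨ *-congʳ inverse ⟨
    den * inv * sfs         ≈⟨ solve 3 (λ x y z → x :* y :* z := x :* z :* y) refl den inv sfs ⟩
    den * sfs * inv         ≈⟨ *-congʳ (superfactorial-+ p q) ⟩
    superfactorial (p ℕ.+ q) * inv ∎
    where
    sfs = superfactorial p * superfactorial q
    d : ℕ → ℕ → ℕ
    d r c = p ℕ.+ q ∸ suc r ∸ suc c
    den = rectangle p q (λ r c → nat (suc (d r c)))
    inv = rectangle p q (λ r c → ι (+ 1 / suc (d r c)))
    inverse : den * inv ≈ 1#
    inverse = begin
      den * inv
        ≈⟨ rectangle-* p q (λ r c → nat (suc (d r c))) (λ r c → ι (+ 1 / suc (d r c))) ⟨
      rectangle p q (λ r c → nat (suc (d r c)) * ι (+ 1 / suc (d r c)))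
        ≈⟨ ∏-cong p {g = λ _ → 1#} (λ r → trans
             (∏-cong q {g = λ _ → 1#} (λ c → ÷suc-inverse (d r c))) (∏-1 q)) ⟩
      ∏< p (λ _ → 1#)
        ≈⟨ ∏-1 p ⟩
      1# ∎

  -- The first product covers the cells (r, c) with c < r, the second those with r ≤ c. They exactly
  -- fill the rectangle because its height exceeds its width by 0 or 1.
  triangles : ∀ n (y : ℕ → ℕ → Carrier) →
    ∏< ⌈ n /2⌉ (λ l → ∏< l (λ k → y l k)) * ∏< ⌊ n /2⌋ (λ m → ∏< (suc m) (λ k → y k m))
      ≈ rectangle ⌈ n /2⌉ ⌊ n /2⌋ y
  triangles zero          y = *-identityˡ _
  triangles (suc zero)    y = *-identityʳ _
  triangles (suc (suc n)) y = begin
    ∏< (suc p) (λ l → ∏< l (y l)) * ∏< (suc q) (λ m → ∏< (suc m) (λ k → y k m))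
      ≈⟨ *-cong (∏-last p (λ l → ∏< l (y l))) (∏-last q (λ m → ∏< (suc m) (λ k → y k m))) ⟩
    (T₁ * ∏< p (y p)) * (T₂ * ∏< (suc q) (λ k → y k q))
      ≈⟨ solve 4 (λ a b c d → (a :* b) :* (c :* d) := (a :* c) :* (b :* d)) refl T₁ (∏< p (y p)) T₂ _ ⟩
    (T₁ * T₂) * (∏< p (y p) * ∏< (suc q) (λ k → y k q))
      ≈⟨ *-cong (triangles n y) ([ diagonal , offDiagonal ]′ (⌈n/2⌉≡⌊n/2⌋⊎1+⌊n/2⌋ n)) ⟩
    rectangle p q y * (∏< p (λ r → y r q) * ∏< (suc q) (y p))
      ≈⟨ *-assoc _ _ _ ⟨
    rectangle p q y * ∏< p (λ r → y r q) * ∏< (suc q) (y p)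
      ≈⟨ *-congʳ (∏-* p (λ r → ∏< q (y r)) (λ r → y r q)) ⟨
    ∏< p (λ r → ∏< q (y r) * y r q) * ∏< (suc q) (y p)
      ≈⟨ *-congʳ (∏-cong p {λ r → ∏< q (y r) * y r q} (λ r → sym (∏-last q (y r)))) ⟩
    rectangle p (suc q) y * ∏< (suc q) (y p)
      ≈⟨ ∏-last p (λ r → ∏< (suc q) (y r)) ⟨
    rectangle (suc p) (suc q) y ∎
    where
    p = ⌈ n /2⌉
    q = ⌊ n /2⌋
    T₁ = ∏< p (λ l → ∏< l (y l))
    T₂ = ∏< q (λ m → ∏< (suc m) (λ k → y k m))
    -- The induction adds row p and column q. For p = q the corner cell (q, q) passes from the
    -- column to the row; for p = q + 1 both sides consist of the same two products.
    Border : ℕ → Set ℓ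
    Border p = ∏< p (y p) * ∏< (suc q) (λ k → y k q) ≈ ∏< p (λ r → y r q) * ∏< (suc q) (y p)
    diagonal : p ≡ q → Border p
    diagonal p≡q = ≡.subst Border (≡.sym p≡q) (begin
      ∏< q (y q) * ∏< (suc q) (λ k → y k q)       ≈⟨ *-congˡ (∏-last q (λ k → y k q)) ⟩
      ∏< q (y q) * (∏< q (λ k → y k q) * y q q)   ≈⟨ solve 3 (λ a b c → a :* (b :* c) := b :* (a :* c)) refl _ _ _ ⟩
      ∏< q (λ k → y k q) * (∏< q (y q) * y q q)   ≈⟨ *-congˡ (∏-last q (y q)) ⟨
      ∏< q (λ k → y k q) * ∏< (suc q) (y q)       ∎)
    offDiagonal : p ≡ suc q → Border p
    offDiagonal p≡1+q = ≡.subst Border (≡.sym p≡1+q) (*-comm _ _)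

-- Reduction of the dilated Hankel matrix to a Vandermonde determinant.

module Evaluation {c ℓ} (A : CommutativeℚAlgebra c ℓ)
  (s t : CommutativeℚAlgebra.Carrier A) where
  open CommutativeℚAlgebra A hiding (zero)
  open Operations A
  open PowerSeries A
  open RationalSolver A
  open SecantPowers A
  open SecantPolynomials A
  open Determinant A
  open Vandermonde A
  open Products A
  open ≈-Reasoning setoid

  γ : ℕ → Carrier
  γ zero          = s + 1#
  γ (suc zero)    = t + 1#
  γ (suc (suc j)) = γ j + 1# + 1#

  f : Series
  f = sec^ (s + 1#) ⊕ ∫₀ˣ (sec^ (t + 1#))

  hankelColumn secantColumn : ℕ → Column
  hankelColumn j i = f (2 ℕ.* i ℕ.+ j)
  secantColumn j i = evenSec i (γ j)

  -- The diagonal of the triangular change of columns: passing from column j to j + 2 costs a factor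
  -- γ_j (γ_j + 1).
  κ : ℕ → Carrier
  κ zero          = 1#
  κ (suc zero)    = 1#
  κ (suc (suc j)) = κ j * (γ j * (γ j + 1#))

  -- Secant powers are even and their integrals odd, so each column of the Hankel matrix sees only
  -- one of the two summands of f.
  sec^-odd : ∀ i x → sec^ x (suc (2 ℕ.* i)) ≈ 0#
  sec^-odd zero    x = sec^-one x
  sec^-odd (suc i) x = begin
    sec^ x (suc (2 ℕ.* suc i))
      ≡⟨ ≡.cong (λ k → sec^ x (suc k)) (ℕ.*-suc 2 i) ⟩
    sec^ x (suc (suc (suc (2 ℕ.* i))))
      ≈⟨ sec^-recurrence x (suc (2 ℕ.* i)) ⟩
    x * (x + 1#) * sec^ (x + 1# + 1#) (suc (2 ℕ.* i)) - x * x * sec^ x (suc (2 ℕ.* i))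
      ≈⟨ +-cong (*-congˡ (sec^-odd i (x + 1# + 1#))) (-‿cong (*-congˡ (sec^-odd i x))) ⟩
    x * (x + 1#) * 0# - x * x * 0#
      ≈⟨ solve 1 (λ x → x :* (x :+ con 1ℚ) :* con 0ℚ :- x :* x :* con 0ℚ := con 0ℚ) refl x ⟩
    0# ∎

  ∫sec^-even : ∀ i x → ∫₀ˣ (sec^ x) (2 ℕ.* i) ≈ 0#
  ∫sec^-even zero    x = refl
  ∫sec^-even (suc i) x = trans (reflexive (≡.cong (∫₀ˣ (sec^ x)) (ℕ.*-suc 2 i))) (sec^-odd i x)

  hankelColumn-0 : ∀ i → hankelColumn 0 i ≈ secantColumn 0 i
  hankelColumn-0 i = begin
    f (2 ℕ.* i ℕ.+ 0)   ≡⟨ ≡.cong f (ℕ.+-identityʳ (2 ℕ.* i)) ⟩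
    f (2 ℕ.* i)         ≈⟨ +-congˡ (∫sec^-even i (t + 1#)) ⟩
    secantColumn 0 i + 0# ≈⟨ +-identityʳ _ ⟩
    secantColumn 0 i    ∎

  hankelColumn-1 : ∀ i → hankelColumn 1 i ≈ secantColumn 1 i
  hankelColumn-1 i = begin
    f (2 ℕ.* i ℕ.+ 1)   ≡⟨ ≡.cong f (ℕ.+-comm (2 ℕ.* i) 1) ⟩
    f (suc (2 ℕ.* i))   ≈⟨ +-congʳ (sec^-odd i (s + 1#)) ⟩
    0# + secantColumn 1 i ≈⟨ +-identityˡ _ ⟩
    secantColumn 1 i    ∎

  -- The effect of the dilation: two columns to the right is one row down. A recurrence in the row
  -- index thereby becomes one between columns.
  hankelColumn-shift : ∀ j i → hankelColumn (suc (suc j)) i ≡ hankelColumn j (suc i)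
  hankelColumn-shift j i = ≡.cong f (≡.trans
    (≡.trans (ℕ.+-suc (2 ℕ.* i) (suc j)) (≡.cong suc (ℕ.+-suc (2 ℕ.* i) j)))
    (≡.cong (ℕ._+ j) (≡.sym (ℕ.*-suc 2 i))))

  secantSpan : ℕ → Column → Set (c ⊔ ℓ)
  secantSpan j = Span (applyUpTo secantColumn j)

  tail-coefficient : Carrier → ℕ → Carrier
  tail-coefficient a j = a * (γ j * (γ j + 1#))

  tail-remainder : Carrier → ℕ → Column → Column
  tail-remainder a j w i = - (a * (γ j * γ j)) * secantColumn j i + w i

  -- One row down, e_j becomes γ_j (γ_j + 1) e_(j+2) - γ_j² e_j. The first term is the new pivot and
  -- the second joins the remainder.
  tail-combination : ∀ a j (w : Column) i →
    a * secantColumn j (suc i) + w i ≈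
    tail-coefficient a j * secantColumn (suc (suc j)) i + tail-remainder a j w i
  tail-combination a j w i = trans
    (+-congʳ (*-congˡ (evenSec-recurrence i (γ j))))
    (regroup a (γ j * (γ j + 1#)) (γ j * γ j)
      (secantColumn (suc (suc j)) i) (secantColumn j i) (w i))
    where
    regroup : ∀ a x y u v w →
      a * (x * u - y * v) + w ≈ a * x * u + (- (a * y) * v + w)
    regroup = solve 6 (λ a x y u v w →
      a :* (x :* u :- y :* v) :+ w := a :* x :* u :+ ((:- (a :* y)) :* v :+ w)) refl

  tail-remainder-span : ∀ {n} a {j w} → j < n →
    secantSpan n w → secantSpan n (tail-remainder a j w)
  tail-remainder-span a {j} {w} j<n w∈ = combine {u = secantColumn j} {w = w}
    (- (a * (γ j * γ j))) (∈-applyUpTo⁺ secantColumn j<n) w∈ (λ i → refl)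

  -- `tail` raises indices by at most 2, in step with the Hankel columns, so that remainders stay in
  -- the span of columns before the pivot.
  tail-span : ∀ {j w} → secantSpan j w → secantSpan (suc (suc j)) (tail w)
  tail-span (null w≈0) = null (λ i → w≈0 (suc i))
  tail-span {j} {v} (combine {u} {w = w} a u∈ w∈ v≈) = step (∈-applyUpTo⁻ secantColumn u∈) v≈
    where
    step : ∀ {u} → ∃[ k ] (k < j & u ≡ secantColumn k) →
      (∀ i → v i ≈ a * u i + w i) → secantSpan (suc (suc j)) (tail v)
    step (k , k<j , ≡.refl) v≈ =
      combine {u = secantColumn (suc (suc k))} {w = tail-remainder a k (tail w)}
        (tail-coefficient a k)
        (∈-applyUpTo⁺ secantColumn (s≤s (s≤s k<j)))
        (tail-remainder-span a (ℕ.m≤n⇒m≤1+n (ℕ.m≤n⇒m≤1+n k<j)) (tail-span w∈))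
        (λ i → trans (v≈ (suc i)) (tail-combination a k (tail w) i))

  Triangular : ℕ → Set (c ⊔ ℓ)
  Triangular j = ∃[ w ] (secantSpan j w & (∀ i → hankelColumn j i ≈ κ j * secantColumn j i + w i))

  triangular-suc-suc : ∀ j → Triangular j → Triangular (suc (suc j))
  triangular-suc-suc j (w , w∈ , eq) =
    tail-remainder (κ j) j (tail w) ,
    tail-remainder-span (κ j) (ℕ.m<n⇒m<1+n (ℕ.n<1+n j)) (tail-span w∈) ,
    λ i → trans (reflexive (hankelColumn-shift j i))
      (trans (eq (suc i)) (tail-combination (κ j) j (tail w) i))

  hankelColumn-triangular : ∀ j → Triangular j
  hankelColumn-triangular zero = (λ _ → 0#) , null (λ _ → refl) , λ i →
    trans (hankelColumn-0 i) (sym (trans (+-identityʳ _) (*-identityˡ _)))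
  hankelColumn-triangular (suc zero) = (λ _ → 0#) , null (λ _ → refl) , λ i →
    trans (hankelColumn-1 i) (sym (trans (+-identityʳ _) (*-identityˡ _)))
  hankelColumn-triangular (suc (suc j)) = triangular-suc-suc j (hankelColumn-triangular j)

  dilatedHankel-vandermonde : ∀ n → dilatedHankel n f ≈
    ∏< n κ * (∏< n oddFactorial * vandermonde (applyUpTo γ n))
  dilatedHankel-vandermonde n = begin
    dilatedHankel n f
      ≈⟨ det≈determinant {n} (λ j → hankelColumn (toℕ j)) ⟩
    determinant n (tabulate {n = n} (λ j → hankelColumn (toℕ j)))
      ≈⟨ triangular (determinant-alternating n) secantColumn hankelColumn
           (λ j → proj₁ (hankelColumn-triangular j)) κ
           (λ j → proj₁ (proj₂ (hankelColumn-triangular j)))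
           (λ j → proj₂ (proj₂ (hankelColumn-triangular j))) n ⟩
    ∏< n κ * determinant n (applyUpTo secantColumn n)
      ≡⟨ ≡.cong (λ z → ∏< n κ * determinant n z) (map-applyUpTo γ (λ x i → evenSec i x) n) ⟨
    ∏< n κ * determinant n (map (λ x i → evenSec i x) (applyUpTo γ n))
      ≈⟨ *-congˡ (≡.subst (λ m → determinant m (map (λ x i → evenSec i x) (applyUpTo γ n)) ≈
             ∏< m oddFactorial * vandermonde (applyUpTo γ n)) (length-applyUpTo γ n)
           (determinant-polynomials evenSec oddFactorial evenSec-poly (applyUpTo γ n))) ⟩
    ∏< n κ * (∏< n oddFactorial * vandermonde (applyUpTo γ n)) ∎

-- Evaluation of the Vandermonde product.

module Factorisation {c ℓ} (A : CommutativeℚAlgebra c ℓ)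
  (s t : CommutativeℚAlgebra.Carrier A) where
  open CommutativeℚAlgebra A hiding (zero)
  open Operations A
  open PowerSeries A
  open RationalSolver A
  open Scalars A
  open LinearCombination commutativeRing
  open SecantPolynomials A
  open Vandermonde A
  open Products A
  open Evaluation A s t
  open ≈-Reasoning setoid

  differences-applyUpTo : ∀ x (f : ℕ → Carrier) n → differences x (applyUpTo f n) ≈ ∏< n (λ j → f j - x)
  differences-applyUpTo x f zero    = refl
  differences-applyUpTo x f (suc n) = *-congˡ (differences-applyUpTo x (λ j → f (suc j)) n)

  -- The recursion groups the differences by their smaller index; grouping them by the larger index
  -- j makes it possible to split by the parity of j.
  vandermonde-applyUpTo : ∀ (f : ℕ → Carrier) n →
    vandermonde (applyUpTo f n) ≈ ∏< n (λ j → ∏< j (λ i → f j - f i))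
  vandermonde-applyUpTo f zero    = refl
  vandermonde-applyUpTo f (suc n) = begin
    differences (f 0) (applyUpTo (λ j → f (suc j)) n) * vandermonde (applyUpTo (λ j → f (suc j)) n)
      ≈⟨ *-cong (differences-applyUpTo (f 0) (λ j → f (suc j)) n)
           (vandermonde-applyUpTo (λ j → f (suc j)) n) ⟩
    ∏< n (λ j → f (suc j) - f 0) * ∏< n (λ j → ∏< j (λ i → f (suc j) - f (suc i)))
      ≈⟨ ∏-* n (λ j → f (suc j) - f 0) (λ j → ∏< j (λ i → f (suc j) - f (suc i))) ⟨
    ∏< n (λ j → ∏< (suc j) (λ i → f (suc j) - f i))
      ≈⟨ *-identityˡ _ ⟨
    ∏< (suc n) (λ j → ∏< j (λ i → f j - f i)) ∎

  2ᴬ : Carrier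
  2ᴬ = nat 2

  [2*i]! : ∀ i → nat ((2 ℕ.* i) !) ≈ oddFactorial i * 2ᴬ ^ i * nat (i !)
  [2*i]! zero    = solve 0 (con 1ℚ :+ con 0ℚ := con 1ℚ :* con 1ℚ :* (con 1ℚ :+ con 0ℚ)) refl
  [2*i]! (suc i) = begin
    nat ((2 ℕ.* suc i) !)
      ≡⟨ ≡.cong (λ k → nat (k !)) (ℕ.*-suc 2 i) ⟩
    nat (suc (suc (2 ℕ.* i)) ℕ.* (suc (2 ℕ.* i) ℕ.* (2 ℕ.* i) !))
      ≈⟨ trans (nat-* (suc (suc (2 ℕ.* i))) (suc (2 ℕ.* i) ℕ.* (2 ℕ.* i) !))
           (*-congˡ (nat-* (suc (2 ℕ.* i)) ((2 ℕ.* i) !))) ⟩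
    nat (suc (suc (2 ℕ.* i))) * (nat (suc (2 ℕ.* i)) * nat ((2 ℕ.* i) !))
      ≈⟨ *-cong
           (trans (reflexive (≡.cong nat (≡.sym (ℕ.*-suc 2 i)))) (nat-* 2 (suc i)))
           (*-congˡ ([2*i]! i)) ⟩
    2ᴬ * nat (suc i) * (nat (suc (2 ℕ.* i)) * (oddFactorial i * 2ᴬ ^ i * nat (i !)))
      ≈⟨ solve 6 (λ a b c d e f → a :* b :* (c :* (d :* e :* f)) := c :* d :* (a :* e) :* (b :* f)) refl
           2ᴬ (nat (suc i)) (nat (suc (2 ℕ.* i))) (oddFactorial i) (2ᴬ ^ i) (nat (i !)) ⟩
    oddFactorial (suc i) * 2ᴬ ^ suc i * (nat (suc i) * nat (i !))
      ≈⟨ *-congˡ (nat-* (suc i) (i !)) ⟨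
    oddFactorial (suc i) * 2ᴬ ^ suc i * nat (suc i !) ∎

  γ-even : ∀ l → γ (2 ℕ.* l) ≈ s + 1# + nat (2 ℕ.* l)
  γ-even zero    = sym (+-identityʳ _)
  γ-even (suc l) = begin
    γ (2 ℕ.* suc l)                         ≡⟨ ≡.cong γ (ℕ.*-suc 2 l) ⟩
    γ (2 ℕ.* l) + 1# + 1#                   ≈⟨ +-congʳ (+-congʳ (γ-even l)) ⟩
    s + 1# + nat (2 ℕ.* l) + 1# + 1#        ≈⟨ solve 2 (λ a n → a :+ n :+ con 1ℚ :+ con 1ℚ
                                                    := a :+ (con 1ℚ :+ (con 1ℚ :+ n))) refl (s + 1#) _ ⟩
    s + 1# + nat (2 ℕ.+ 2 ℕ.* l)            ≡⟨ ≡.cong (λ k → s + 1# + nat k) (ℕ.*-suc 2 l) ⟨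
    s + 1# + nat (2 ℕ.* suc l)              ∎

  γ-odd : ∀ m → γ (suc (2 ℕ.* m)) ≈ t + 1# + nat (2 ℕ.* m)
  γ-odd zero    = sym (+-identityʳ _)
  γ-odd (suc m) = begin
    γ (suc (2 ℕ.* suc m))                   ≡⟨ ≡.cong (λ k → γ (suc k)) (ℕ.*-suc 2 m) ⟩
    γ (suc (2 ℕ.* m)) + 1# + 1#             ≈⟨ +-congʳ (+-congʳ (γ-odd m)) ⟩
    t + 1# + nat (2 ℕ.* m) + 1# + 1#        ≈⟨ solve 2 (λ a n → a :+ n :+ con 1ℚ :+ con 1ℚ
                                                    := a :+ (con 1ℚ :+ (con 1ℚ :+ n))) refl (t + 1#) _ ⟩
    t + 1# + nat (2 ℕ.+ 2 ℕ.* m)            ≡⟨ ≡.cong (λ k → t + 1# + nat k) (ℕ.*-suc 2 m) ⟨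
    t + 1# + nat (2 ℕ.* suc m)              ∎

  pochhammer-2+ : ∀ a k → pochhammer a (2 ℕ.+ k) ≈ pochhammer a k * ((a + nat k) * (a + nat k + 1#))
  pochhammer-2+ a k = begin
    pochhammer a (2 ℕ.+ k)
      ≈⟨ ∏-last (suc k) (λ i → a + nat i) ⟩
    pochhammer a (suc k) * (a + nat (suc k))
      ≈⟨ *-congʳ (∏-last k (λ i → a + nat i)) ⟩
    pochhammer a k * (a + nat k) * (a + (1# + nat k))
      ≈⟨ solve 3 (λ p a n → p :* (a :+ n) :* (a :+ (con 1ℚ :+ n)) := p :* ((a :+ n) :* (a :+ n :+ con 1ℚ))) refl
           (pochhammer a k) a (nat k) ⟩
    pochhammer a k * ((a + nat k) * (a + nat k + 1#)) ∎

  κ-even : ∀ l → κ (2 ℕ.* l) ≈ pochhammer (s + 1#) (2 ℕ.* l)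
  κ-even zero    = refl
  κ-even (suc l) = begin
    κ (2 ℕ.* suc l)
      ≡⟨ ≡.cong κ (ℕ.*-suc 2 l) ⟩
    κ (2 ℕ.* l) * (γ (2 ℕ.* l) * (γ (2 ℕ.* l) + 1#))
      ≈⟨ *-cong (κ-even l) (*-cong (γ-even l) (+-congʳ (γ-even l))) ⟩
    pochhammer (s + 1#) (2 ℕ.* l) * ((s + 1# + nat (2 ℕ.* l)) * (s + 1# + nat (2 ℕ.* l) + 1#))
      ≈⟨ pochhammer-2+ (s + 1#) (2 ℕ.* l) ⟨
    pochhammer (s + 1#) (2 ℕ.+ 2 ℕ.* l)
      ≡⟨ ≡.cong (pochhammer (s + 1#)) (ℕ.*-suc 2 l) ⟨
    pochhammer (s + 1#) (2 ℕ.* suc l) ∎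

  κ-odd : ∀ m → κ (suc (2 ℕ.* m)) ≈ pochhammer (t + 1#) (2 ℕ.* m)
  κ-odd zero    = refl
  κ-odd (suc m) = begin
    κ (suc (2 ℕ.* suc m))
      ≡⟨ ≡.cong (λ k → κ (suc k)) (ℕ.*-suc 2 m) ⟩
    κ (suc (2 ℕ.* m)) * (γ (suc (2 ℕ.* m)) * (γ (suc (2 ℕ.* m)) + 1#))
      ≈⟨ *-cong (κ-odd m) (*-cong (γ-odd m) (+-congʳ (γ-odd m))) ⟩
    pochhammer (t + 1#) (2 ℕ.* m) * ((t + 1# + nat (2 ℕ.* m)) * (t + 1# + nat (2 ℕ.* m) + 1#))
      ≈⟨ pochhammer-2+ (t + 1#) (2 ℕ.* m) ⟨
    pochhammer (t + 1#) (2 ℕ.+ 2 ℕ.* m)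
      ≡⟨ ≡.cong (pochhammer (t + 1#)) (ℕ.*-suc 2 m) ⟨
    pochhammer (t + 1#) (2 ℕ.* suc m) ∎

  -- The successors reproduce the one-based c and r of the formula. Twice this factor is γ (2 c₀ +
  -- 1) - γ (2 r₀).
  crossFactor : ℕ → ℕ → Carrier
  crossFactor r₀ c₀ = (t - s) ÷suc 1 + nat (suc c₀) - nat (suc r₀)

  2*crossFactor : ∀ r c → 2ᴬ * crossFactor r c ≈ (t + 1# + nat (2 ℕ.* c)) - (s + 1# + nat (2 ℕ.* r))
  2*crossFactor r c = combine₃ (t - s) (- 1#) 1# (÷suc-inverse 1) (nat-* 2 c) (nat-* 2 r)
    (solve 8 (λ s t h c r two 2c 2r →
        two :* ((t :- s) :* h :+ (con 1ℚ :+ c) :- (con 1ℚ :+ r)) :=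
        ((t :+ con 1ℚ :+ 2c) :- (s :+ con 1ℚ :+ 2r))
        :+ (t :- s) :* (two :* h :- con 1ℚ)
        :+ (:- con 1ℚ) :* (2c :- two :* c) :+ con 1ℚ :* (2r :- two :* r))
      refl s t (ι (+ 1 / 2)) (nat c) (nat r) 2ᴬ (nat (2 ℕ.* c)) (nat (2 ℕ.* r)))

  2*[nat-nat] : ∀ a l k → a + nat (2 ℕ.* l) - (a + nat (2 ℕ.* k)) ≈ 2ᴬ * (nat l - nat k)
  2*[nat-nat] a l k = combine₂ 1# (- 1#) (nat-* 2 l) (nat-* 2 k)
    (solve 6 (λ a l k two 2l 2k → a :+ 2l :- (a :+ 2k) :=
        two :* (l :- k) :+ con 1ℚ :* (2l :- two :* l) :+ (:- con 1ℚ) :* (2k :- two :* k))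
      refl a (nat l) (nat k) 2ᴬ (nat (2 ℕ.* l)) (nat (2 ℕ.* k)))

  ∏-sameParity : ∀ l (f : ℕ → Carrier) a → (∀ k → f k ≈ a + nat (2 ℕ.* k)) →
    ∏< l (λ k → f l - f k) ≈ 2ᴬ ^ l * nat (l !)
  ∏-sameParity l f a f≈ = begin
    ∏< l (λ k → f l - f k)
      ≈⟨ ∏-cong l {λ k → f l - f k} (λ k → trans (+-cong (f≈ l) (-‿cong (f≈ k))) (2*[nat-nat] a l k)) ⟩
    ∏< l (λ k → 2ᴬ * (nat l - nat k))
      ≈⟨ ∏-scale l 2ᴬ (λ k → nat l - nat k) ⟩
    2ᴬ ^ l * ∏< l (λ k → nat l - nat k)
      ≈⟨ *-congˡ (∏-nat-nat l) ⟩
    2ᴬ ^ l * nat (l !) ∎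

  Δγ : ℕ → Carrier
  Δγ j = ∏< j (λ i → γ j - γ i)

  -- Node 2l has l predecessors of its own parity, giving 2^l l!, and l of the other parity, giving
  -- 2^l and the cross factors of row l. In the latter s and t stand in reverse order, hence the
  -- sign (-1)^l.
  Δγ-even : ∀ l → Δγ (2 ℕ.* l) ≈
    2ᴬ ^ (2 ℕ.* l) * ((- 1#) ^ l * (nat (l !) * ∏< l (crossFactor l)))
  Δγ-even l = begin
    Δγ (2 ℕ.* l)
      ≈⟨ ∏-even l (λ i → γ (2 ℕ.* l) - γ i) ⟩
    ∏< l (λ k → γ (2 ℕ.* l) - γ (2 ℕ.* k)) * ∏< l (λ k → γ (2 ℕ.* l) - γ (suc (2 ℕ.* k)))
      ≈⟨ *-cong (∏-sameParity l (λ k → γ (2 ℕ.* k)) (s + 1#) γ-even) cross ⟩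
    2ᴬ ^ l * nat (l !) * ((- 1#) ^ l * (2ᴬ ^ l * ∏< l (crossFactor l)))
      ≈⟨ solve 4 (λ p x y z → p :* x :* (y :* (p :* z)) := p :* p :* (y :* (x :* z))) refl
           (2ᴬ ^ l) (nat (l !)) ((- 1#) ^ l) (∏< l (crossFactor l)) ⟩
    2ᴬ ^ l * 2ᴬ ^ l * ((- 1#) ^ l * (nat (l !) * ∏< l (crossFactor l)))
      ≈⟨ *-congʳ (^-double 2ᴬ l) ⟨
    2ᴬ ^ (2 ℕ.* l) * ((- 1#) ^ l * (nat (l !) * ∏< l (crossFactor l))) ∎
    where
    cross : ∏< l (λ k → γ (2 ℕ.* l) - γ (suc (2 ℕ.* k))) ≈ (- 1#) ^ l * (2ᴬ ^ l * ∏< l (crossFactor l))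
    cross = begin
      ∏< l (λ k → γ (2 ℕ.* l) - γ (suc (2 ℕ.* k)))
        ≈⟨ ∏-cong l {λ k → γ (2 ℕ.* l) - γ (suc (2 ℕ.* k))} (λ k → begin
             γ (2 ℕ.* l) - γ (suc (2 ℕ.* k))
               ≈⟨ +-cong (γ-even l) (-‿cong (γ-odd k)) ⟩
             s + 1# + nat (2 ℕ.* l) - (t + 1# + nat (2 ℕ.* k))
               ≈⟨ solve 2 (λ x y → x :- y := (:- con 1ℚ) :* (y :- x)) refl _ _ ⟩
             - 1# * ((t + 1# + nat (2 ℕ.* k)) - (s + 1# + nat (2 ℕ.* l)))
               ≈⟨ *-congˡ (2*crossFactor l k) ⟨
             - 1# * (2ᴬ * crossFactor l k) ∎) ⟩
      ∏< l (λ k → - 1# * (2ᴬ * crossFactor l k))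
        ≈⟨ ∏-scale l (- 1#) (λ k → 2ᴬ * crossFactor l k) ⟩
      (- 1#) ^ l * ∏< l (λ k → 2ᴬ * crossFactor l k)
        ≈⟨ *-congˡ (∏-scale l 2ᴬ (crossFactor l)) ⟩
      (- 1#) ^ l * (2ᴬ ^ l * ∏< l (crossFactor l)) ∎

  -- All m + 1 predecessors of even index appear in the order t minus s, so there is no sign; they
  -- include k = m, which puts the diagonal cell into this product.
  Δγ-odd : ∀ m → Δγ (suc (2 ℕ.* m)) ≈
    2ᴬ ^ suc (2 ℕ.* m) * (nat (m !) * ∏< (suc m) (λ k → crossFactor k m))
  Δγ-odd m = begin
    Δγ (suc (2 ℕ.* m))
      ≈⟨ ∏-odd m (λ i → γ (suc (2 ℕ.* m)) - γ i) ⟩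
    ∏< (suc m) (λ k → γ (suc (2 ℕ.* m)) - γ (2 ℕ.* k)) * ∏< m (λ k → γ (suc (2 ℕ.* m)) - γ (suc (2 ℕ.* k)))
      ≈⟨ *-cong
           (∏-cong (suc m) {λ k → γ (suc (2 ℕ.* m)) - γ (2 ℕ.* k)} (λ k → trans
             (+-cong (γ-odd m) (-‿cong (γ-even k))) (sym (2*crossFactor k m))))
           (∏-sameParity m (λ k → γ (suc (2 ℕ.* k))) (t + 1#) γ-odd) ⟩
    ∏< (suc m) (λ k → 2ᴬ * crossFactor k m) * (2ᴬ ^ m * nat (m !))
      ≈⟨ *-congʳ (∏-scale (suc m) 2ᴬ (λ k → crossFactor k m)) ⟩
    2ᴬ ^ suc m * y * (2ᴬ ^ m * nat (m !))
      ≈⟨ solve 4 (λ two p x y → two :* p :* y :* (p :* x) := two :* (p :* p) :* (x :* y)) refl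
           2ᴬ (2ᴬ ^ m) (nat (m !)) y ⟩
    2ᴬ * (2ᴬ ^ m * 2ᴬ ^ m) * (nat (m !) * y)
      ≈⟨ *-congʳ (*-congˡ (^-double 2ᴬ m)) ⟨
    2ᴬ ^ suc (2 ℕ.* m) * (nat (m !) * y) ∎
    where y = ∏< (suc m) (λ k → crossFactor k m)

  module _ (n : ℕ) where
    p q : ℕ
    p = ⌈ n /2⌉
    q = ⌊ n /2⌋

    sign twosₑ twosₒ T₁ T₂ odds : Carrier
    sign  = (- 1#) ^ (p C 2)
    twosₑ = ∏< p (λ l → 2ᴬ ^ (2 ℕ.* l))
    twosₒ = ∏< q (λ m → 2ᴬ ^ suc (2 ℕ.* m))
    T₁ = ∏< p (λ l → ∏< l (crossFactor l))
    T₂ = ∏< q (λ m → ∏< (suc m) (λ k → crossFactor k m))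
    odds = ∏< n oddFactorial

    ∏κ : ∏< n κ ≈
      ∏< p (λ l → pochhammer (s + 1#) (2 ℕ.* l)) * ∏< q (λ m → pochhammer (t + 1#) (2 ℕ.* m))
    ∏κ = trans (∏-parity n κ) (*-cong
      (∏-cong p {λ l → κ (2 ℕ.* l)} κ-even) (∏-cong q {λ m → κ (suc (2 ℕ.* m))} κ-odd))

    ∏Δγ : ∏< n Δγ ≈
      twosₑ * (sign * (superfactorial p * T₁)) * (twosₒ * (superfactorial q * T₂))
    ∏Δγ = trans (∏-parity n Δγ) (*-cong
      (begin
        ∏< p (λ l → Δγ (2 ℕ.* l))
          ≈⟨ ∏-cong p {λ l → Δγ (2 ℕ.* l)} Δγ-even ⟩
        ∏< p (λ l → 2ᴬ ^ (2 ℕ.* l) * ((- 1#) ^ l * (nat (l !) * ∏< l (crossFactor l))))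
          ≈⟨ ∏-* p (λ l → 2ᴬ ^ (2 ℕ.* l)) (λ l → (- 1#) ^ l * (nat (l !) * ∏< l (crossFactor l))) ⟩
        twosₑ * ∏< p (λ l → (- 1#) ^ l * (nat (l !) * ∏< l (crossFactor l)))
          ≈⟨ *-congˡ (∏-* p (λ l → (- 1#) ^ l) (λ l → nat (l !) * ∏< l (crossFactor l))) ⟩
        twosₑ * (∏< p (λ l → (- 1#) ^ l) * ∏< p (λ l → nat (l !) * ∏< l (crossFactor l)))
          ≈⟨ *-congˡ (*-cong (∏-sign p) (∏-* p (λ l → nat (l !)) (λ l → ∏< l (crossFactor l)))) ⟩
        twosₑ * (sign * (superfactorial p * T₁)) ∎)
      (begin
        ∏< q (λ m → Δγ (suc (2 ℕ.* m)))
          ≈⟨ ∏-cong q {λ m → Δγ (suc (2 ℕ.* m))} Δγ-odd ⟩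
        ∏< q (λ m → 2ᴬ ^ suc (2 ℕ.* m) * (nat (m !) * ∏< (suc m) (λ k → crossFactor k m)))
          ≈⟨ ∏-* q (λ m → 2ᴬ ^ suc (2 ℕ.* m)) (λ m → nat (m !) * ∏< (suc m) (λ k → crossFactor k m)) ⟩
        twosₒ * ∏< q (λ m → nat (m !) * ∏< (suc m) (λ k → crossFactor k m))
          ≈⟨ *-congˡ (∏-* q (λ m → nat (m !)) (λ m → ∏< (suc m) (λ k → crossFactor k m))) ⟩
        twosₒ * (superfactorial q * T₂) ∎))

    ∏[2*i]! : ∏< n (λ i → nat ((2 ℕ.* i) !)) ≈ odds * (twosₑ * twosₒ) * superfactorial n
    ∏[2*i]! = begin
      ∏< n (λ i → nat ((2 ℕ.* i) !))
        ≈⟨ ∏-cong n {λ i → nat ((2 ℕ.* i) !)} [2*i]! ⟩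
      ∏< n (λ i → oddFactorial i * 2ᴬ ^ i * nat (i !))
        ≈⟨ ∏-* n (λ i → oddFactorial i * 2ᴬ ^ i) (λ i → nat (i !)) ⟩
      ∏< n (λ i → oddFactorial i * 2ᴬ ^ i) * superfactorial n
        ≈⟨ *-congʳ (∏-* n oddFactorial (2ᴬ ^_)) ⟩
      odds * ∏< n (2ᴬ ^_) * superfactorial n
        -- The powers of 2 need no evaluation: split by parity they are the very products that occur
        -- in `∏Δγ`.
        ≈⟨ *-congʳ (*-congˡ (∏-parity n (2ᴬ ^_))) ⟩
      odds * (twosₑ * twosₒ) * superfactorial n ∎

    inverseFactor : ℕ → ℕ → Carrier
    inverseFactor r c = ι (+ 1 / suc (n ∸ suc r ∸ suc c))

    superfactorial-parity : superfactorial p * superfactorial q ≈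
      superfactorial n * rectangle p q inverseFactor
    superfactorial-parity = ≡.subst
      (λ k → superfactorial p * superfactorial q ≈
        superfactorial k * rectangle p q (λ r c → ι (+ 1 / suc (k ∸ suc r ∸ suc c))))
      (≡.trans (ℕ.+-comm p q) (ℕ.⌊n/2⌋+⌈n/2⌉≡n n))
      (superfactorial-÷ p q)

    dilatedHankel-product : dilatedHankel n f ≈
      sign * ∏< n (λ i → nat ((2 ℕ.* i) !))
        * ∏< p (λ l → pochhammer (s + 1#) (2 ℕ.* l))
        * ∏< q (λ m → pochhammer (t + 1#) (2 ℕ.* m))
        * rectangle p q (λ r₀ c₀ → crossFactor r₀ c₀ ÷suc (n ∸ suc r₀ ∸ suc c₀))
    dilatedHankel-product = begin
      dilatedHankel n f
        ≈⟨ dilatedHankel-vandermonde n ⟩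
      ∏< n κ * (odds * vandermonde (applyUpTo γ n))
        ≈⟨ *-cong ∏κ (*-congˡ (trans (vandermonde-applyUpTo γ n) ∏Δγ)) ⟩
      Πs * Πt * (odds * (twosₑ * (sign * (superfactorial p * T₁)) * (twosₒ * (superfactorial q * T₂))))
        ≈⟨ solve 10 (λ a b o e g x u h y v →
             a :* b :* (o :* (e :* (g :* (x :* u)) :* (h :* (y :* v)))) :=
             g :* (o :* (e :* h)) :* a :* b :* ((x :* y) :* (u :* v))) refl
             Πs Πt odds twosₑ sign (superfactorial p) T₁ twosₒ (superfactorial q) T₂ ⟩
      sign * (odds * (twosₑ * twosₒ)) * Πs * Πt * ((superfactorial p * superfactorial q) * (T₁ * T₂))
        -- The superfactorials of p and q are traded for that of n, which completes the factorials
        -- (2i)!; the price is the array of denominators.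
        ≈⟨ *-congˡ (*-cong superfactorial-parity (triangles n crossFactor)) ⟩
      sign * (odds * (twosₑ * twosₒ)) * Πs * Πt
        * ((superfactorial n * rectangle p q inverseFactor) * rectangle p q crossFactor)
        ≈⟨ solve 7 (λ g o a b x d y →
             g :* o :* a :* b :* ((x :* d) :* y) := g :* (o :* x) :* a :* b :* (y :* d)) refl
             sign (odds * (twosₑ * twosₒ)) Πs Πt (superfactorial n)
             (rectangle p q inverseFactor) (rectangle p q crossFactor) ⟩
      sign * (odds * (twosₑ * twosₒ) * superfactorial n) * Πs * Πt
        * (rectangle p q crossFactor * rectangle p q inverseFactor)
        ≈⟨ *-cong (*-congʳ (*-congʳ (*-congˡ (sym ∏[2*i]!))))
             (sym (rectangle-* p q crossFactor inverseFactor)) ⟩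
      sign * ∏< n (λ i → nat ((2 ℕ.* i) !)) * Πs * Πt
        * rectangle p q (λ r₀ c₀ → crossFactor r₀ c₀ ÷suc (n ∸ suc r₀ ∸ suc c₀)) ∎
      where
      Πs Πt : Carrier
      Πs = ∏< p (λ l → pochhammer (s + 1#) (2 ℕ.* l))
      Πt = ∏< q (λ m → pochhammer (t + 1#) (2 ℕ.* m))

proposition7p1 :
  ∀ {c ℓ} (A : CommutativeℚAlgebra c ℓ) →
  let open CommutativeℚAlgebra A
      open Operations A
      open PowerSeries A
  in
  (s t : Carrier) (n : ℕ) → 1 ≤ n →
  let f  = recip (cos ^ˢ (s + 1#)) ⊕ ∫₀ˣ (recip (cos ^ˢ (t + 1#)))
      n⁺ = ⌈ n /2⌉
      n⁻ = ⌊ n /2⌋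
  in
  dilatedHankel n f
    ≈ (- 1#) ^ (n⁺ C 2)
      * (∏[ i < n ] nat ((2 ℕ.* i) !))
      * (∏[ l < n⁺ ] pochhammer (s + 1#) (2 ℕ.* l))
      * (∏[ m < n⁻ ] pochhammer (t + 1#) (2 ℕ.* m))
      -- r = r₀ + 1 and c = c₀ + 1 satisfy r + c ≤ n, so ∸ never truncates
      -- and the denominator is n - r - c + 1.
      * (∏[ r₀ < n⁺ ] ∏[ c₀ < n⁻ ]
          (((t - s) ÷suc 1 + nat (suc c₀) - nat (suc r₀))
            ÷suc (n ∸ suc r₀ ∸ suc c₀)))
proposition7p1 A s t n _ = Factorisation.dilatedHankel-product A s t n
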